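{- Let $n,s,t$ be positive integers and let $Z_{n,s,t}$ be the polynomial $$Z_{n,s,t}=\left(\sum_{i=1}^{sn}x_i\right)^{t-1}\prod_{j=1}^{n-1}\left(\sum_{i=1}^{sj}x_i\right)^{t}.$$ Then the set of distinct monomials in $Z_{n,s,t}$ is equinumerous with the set of lattice paths from $(0,0)$ to $(sn-1,tn-1)$ lying weakly beneath $U^{t-1}(R^sU^t)^{n-1}R^{s-1}$. Moreover, $$N(Z_{n,s,t})=\sum_{(k_1,\dots,k_n)\in L_{n,t}}\ \prod_{i=1}^n\binom{k_i+s-1}{k_i}=\frac1n\binom{(s+t)n-2}{n-1},$$ where $$L_{n,t}=\Big\{(k_1,\dots,k_n)\in\mathbb{N}^n:\ k_1+\cdots+k_j\le tj-1\text{ for }1\le j\le n,\ \sum_{j=1}^n k_j=tn-1\Big\}.$$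
   Context: $\mathbb{N}=\{0,1,2,\dots\}$. $N(Z_{n,s,t})$ denotes the number of nonzero coefficients of $Z_{n,s,t}$ (a polynomial with integer coefficients), i.e. the number of distinct monomials in its expansion. $U=(0,1)$ and $R=(1,0)$ denote up and right steps, and the lattice paths have steps $U$ and $R$; a word in $U,R$ denotes the lattice path starting at $(0,0)$ with those successive steps (exponents denote repetition). A path lies weakly beneath another with the same endpoints if it never goes strictly above it (it may touch it).
   Formalization: The last binomial coefficient is corrected: its lower index is tn−1 instead of n−1, since the printed formula fails (n=1, s=t=2 gives 1 while N=2); the two agree when s=1 or t=1. -}

module Defs where

open import Data.Bool.Base using (if_then_else_)
open import Data.Fin.Base using (Fin; toℕ)
open import Data.Fin.Properties using (all?)
open import Data.Integer.Base as ℤ using (ℤ; 0ℤ; 1ℤ)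
import Data.Integer.Properties as ℤₚ
open import Data.List.Base as List
  using (List; []; _∷_; _++_; map; foldr; foldl; filter; allFin; upTo; replicate;
         concat; take; length; deduplicate; cartesianProductWith)
open import Data.List.Membership.Propositional using (_∈_)
open import Data.Nat.Base using (ℕ; zero; suc; _+_; _*_; _∸_; _≤_; _<_)
open import Data.Nat.Combinatorics using (_C_)
open import Data.Nat.ListAction using (sum; product)
import Data.Nat.Properties as ℕₚ
open import Data.Product.Base using (Σ; _×_; _,_; proj₂)
open import Data.Vec.Base as Vec using (Vec; toList; zipWith; _[_]≔_)
import Data.Vec.Properties as Vecₚ
open import Relation.Binary.Definitions using (DecidableEquality)
open import Relation.Binary.PropositionalEquality using (_≡_; _≢_)
open import Relation.Nullary using (¬_; does)
open import Relation.Nullary.Decidable using (_×-dec_; ¬?)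
open import Relation.Unary using (Decidable)

------------------------------------------------------------------------
-- Polynomials in m variables over ℤ

-- The vector (e₁ , … , eₘ) stands for x₁^e₁ ⋯ xₘ^eₘ.
Exponent : ℕ → Set
Exponent m = Vec ℕ m

_≟ᵉ_ : ∀ {m} → DecidableEquality (Exponent m)
_≟ᵉ_ = Vecₚ.≡-dec ℕₚ._≟_

-- A formal sum of terms in which like terms need not have been collected;
-- `coeff` collects them, and two lists denote the same polynomial when their
-- `coeff`s agree.
Poly : ℕ → Set
Poly m = List (ℤ × Exponent m)

coeff : ∀ {m} → Poly m → Exponent m → ℤ
coeff []            e = 0ℤ
coeff ((c , d) ∷ p) e = if does (d ≟ᵉ e) then c ℤ.+ coeff p e else coeff p e

0ᴾ 1ᴾ : ∀ {m} → Poly m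
0ᴾ     = []
1ᴾ {m} = (1ℤ , Vec.replicate m 0) ∷ []

x : ∀ {m} → Fin m → Poly m
x {m} i = (1ℤ , Vec.replicate m 0 [ i ]≔ 1) ∷ []

infixl 6 _+ᴾ_
infixl 7 _*ᴾ_
infixr 8 _^ᴾ_

_+ᴾ_ _*ᴾ_ : ∀ {m} → Poly m → Poly m → Poly m
_+ᴾ_ = _++_
_*ᴾ_ = cartesianProductWith λ (c , d) (c′ , d′) → c ℤ.* c′ , zipWith _+_ d d′

_^ᴾ_ : ∀ {m} → Poly m → ℕ → Poly m
p ^ᴾ zero  = 1ᴾ
p ^ᴾ suc k = p *ᴾ p ^ᴾ k

-- x₁ + ⋯ + xₖ; the variable xᵢ is `x` at the index with toℕ equal to i - 1.
sumVars : ∀ {m} → ℕ → Poly m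
sumVars {m} k = foldr _+ᴾ_ 0ᴾ (map x (filter (λ i → toℕ i ℕₚ.<? k) (allFin m)))

Z : (n s t : ℕ) → Poly (s * n)
Z n s t = sumVars (s * n) ^ᴾ (t ∸ 1)
       *ᴾ foldr _*ᴾ_ 1ᴾ (map (λ j → sumVars (s * j) ^ᴾ t) (map suc (upTo (n ∸ 1))))

-- The second components are functions into ⊥, whose elements are
-- definitionally equal, so this is the set {e | coeff p e ≢ 0}.
Monomial : ∀ {m} → Poly m → Set
Monomial {m} p = Σ (Exponent m) λ e → coeff p e ≢ 0ℤ

-- The number of nonzero coefficients.  An exponent vector carried by no term
-- of p has coefficient 0, so only those that occur in p need testing.
N : ∀ {m} → Poly m → ℕ
N p = length (filter (λ e → ¬? (coeff p e ℤₚ.≟ 0ℤ)) (deduplicate _≟ᵉ_ (map proj₂ p)))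

------------------------------------------------------------------------
-- Lattice paths

data Step : Set where
  U R : Step

Point : Set
Point = ℕ × ℕ

Path : Set
Path = List Step

move : Point → Step → Point
move (a , b) U = a , suc b
move (a , b) R = suc a , b

pointsFrom : Point → Path → List Point
pointsFrom p []      = p ∷ []
pointsFrom p (u ∷ w) = p ∷ pointsFrom (move p u) w

points : Path → List Point
points = pointsFrom (0 , 0)

endpoint : Path → Point
endpoint = foldl move (0 , 0)

-- Meaningful when Q meets the vertical line through the point, as it does for
-- every point of a path with the same endpoints as Q.
StrictlyAbove : Point → Path → Set
StrictlyAbove (a , b) Q = ∀ {b′} → (a , b′) ∈ points Q → b′ < b

-- Testing lattice points suffices because all steps are unit steps.
WeaklyBeneath : Path → Path → Set
WeaklyBeneath P Q = ∀ {p} → p ∈ points P → ¬ StrictlyAbove p Q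

-- As for `Monomial`, the conditions have at most one proof, so elements of
-- this type are distinguished by their underlying paths only.
PathsBeneath : Point → Path → Set
PathsBeneath p Q = Σ Path λ P → endpoint P ≡ p × WeaklyBeneath P Q

-- U^{t-1} (R^s U^t)^{n-1} R^{s-1}
boundary : (n s t : ℕ) → Path
boundary n s t = replicate (t ∸ 1) U
              ++ concat (replicate (n ∸ 1) (replicate s R ++ replicate t U))
              ++ replicate (s ∸ 1) R

------------------------------------------------------------------------
-- The index set L_{n,t} and the sum over it

-- The index j runs from 0 to n - 1, hence the shift by one.
_∈L_ : ∀ {n} → Vec ℕ n → ℕ → Set
_∈L_ {n} k t =
    (∀ (j : Fin n) → sum (take (suc (toℕ j)) (toList k)) ≤ t * suc (toℕ j) ∸ 1)
  × sum (toList k) ≡ t * n ∸ 1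

∈L? : ∀ {n} t → Decidable (λ (k : Vec ℕ n) → k ∈L t)
∈L? {n} t k =
  all? (λ j → sum (take (suc (toℕ j)) (toList k)) ℕₚ.≤? t * suc (toℕ j) ∸ 1)
  ×-dec sum (toList k) ℕₚ.≟ t * n ∸ 1

-- All vectors with entries < b, each listed once.
box : (n b : ℕ) → List (Vec ℕ n)
box zero    b = Vec.[] ∷ []
box (suc n) b = cartesianProductWith Vec._∷_ (upTo b) (box n b)

-- For n and t positive, the entries of a member of L_{n,t} sum to t n - 1, so
-- each is < t n and the box contains all of L_{n,t}.
L : (n t : ℕ) → List (Vec ℕ n)
L n t = filter (∈L? t) (box n (t * n))

sumOverL : (n s t : ℕ) → ℕ
sumOverL n s t =
  sum (map (λ k → product (map (λ kᵢ → (kᵢ + s ∸ 1) C kᵢ) (toList k))) (L n t))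

{-# OPTIONS --safe #-}

-- Every term of the expanded product has coefficient 1, so nothing cancels and
-- e is the exponent of a monomial of Z iff the factors can be assigned variables
-- with multiplicities e.  As the variable sets of the factors form a chain,
-- greedy assignment succeeds iff Hall's condition holds: e₁ + ⋯ + e_{si} ≥ t i
-- for i < n.  Reversing e and adding up its blocks of length s turns this into
-- membership in L_{n,t}; the reversed exponents are also the numbers of up steps
-- in the successive columns of a path, and the top of a block is where the path
-- can cross the boundary.
--
-- Summing ∏ C(kᵢ+s-1, kᵢ) over all k with k₁ + ⋯ + kₙ = t n - 1 counts vectors of
-- length s n with that sum.  By the cycle lemma exactly one of the n rotations
-- of such a k lies in L_{n,t}, whence the factor 1/n.
module Submission where

open import Defs
open import Data.Bool.Base using (if_then_else_; true; false)
open import Data.Fin.Base as Fin using (Fin; toℕ; fromℕ<)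
open import Data.Fin.Properties using (all?; toℕ<n; toℕ-fromℕ<)
open import Data.Integer.Base as ℤ using (0ℤ; 1ℤ)
import Data.Integer.Properties as ℤₚ
open import Data.List.Base as List
  using (List; []; _∷_; _++_; map; filter; foldr; foldl; replicate; concat; upTo; applyUpTo;
         allFin; take; drop; length; deduplicate; cartesianProductWith)
open import Data.List.Membership.Propositional using (_∈_)
open import Data.List.Membership.Propositional.Properties
  using (∈-map⁺; ∈-map⁻; ∈-filter⁺; ∈-filter⁻; ∈-concat⁺′; ∈-concat⁻′; ∈-allFin; ∈-upTo⁺;
         ∈-deduplicate⁺; ∈-cartesianProductWith⁺; ∈-cartesianProductWith⁻)
open import Data.List.Membership.Propositional.Properties.WithK using (unique∧set⇒bag)
import Data.List.Properties as Listₚ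
open import Data.List.Relation.Binary.BagAndSetEquality using (∼bag⇒↭)
open import Data.List.Relation.Binary.Permutation.Propositional using (_↭_; ↭-refl; ↭-trans)
open import Data.List.Relation.Binary.Permutation.Propositional.Properties
  using (++-comm; ↭-length; ↭-reverse) renaming (map⁺ to ↭-map⁺)
open import Data.List.Relation.Unary.All using ([]; _∷_)
open import Data.List.Relation.Unary.AllPairs using ([]; _∷_)
open import Data.List.Relation.Unary.Any using (here; there)
open import Data.List.Relation.Unary.Unique.DecPropositional.Properties using (deduplicate-!)
open import Data.List.Relation.Unary.Unique.Propositional using (Unique)
import Data.List.Relation.Unary.Unique.Propositional.Properties as Uniqueₚ
import Data.Nat.Base as ℕ
open import Data.Nat.Base hiding (_/_)
open import Data.Nat.Combinatorics
  using (_C_; nCk+nC[k+1]≡[n+1]C[k+1]; k>n⇒nCk≡0; nCk≡nC[n∸k]; nCn≡1)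
open import Data.Nat.DivMod using (m≡m%n+[m/n]*n; m%n<n; m<n*o⇒m/o<n)
open import Data.Nat.ListAction using (sum; product)
open import Data.Nat.ListAction.Properties using (sum-++; sum-↭; product-↭)
open import Data.Nat.Properties hiding (≡-irrelevant)
open import Algebra.Properties.CommutativeSemigroup +-commutativeSemigroup using (interchange; x∙yz≈yx∙z)
open import Data.Nat.Tactic.RingSolver using (solve-∀)
open import Data.Product.Base using (∃-syntax; _×_; _,_; proj₁; proj₂)
open import Data.Rational.Base as ℚ using (fromℚᵘ; toℚᵘ)
import Data.Rational.Properties as ℚₚ
open import Data.Rational.Unnormalised.Base as ℚᵘ using (mkℚᵘ; *≡*)
import Data.Rational.Unnormalised.Properties as ℚᵘₚ
open import Data.Sum.Base using (_⊎_; inj₁; inj₂)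
open import Data.Vec.Base as Vec using (Vec; []; _∷_; _∷ʳ_; head; reverse; toList; zipWith; _[_]≔_)
import Data.Vec.Properties as Vecₚ
open import Function.Base using (_∘_; case_of_)
open import Function.Bundles using (_⇔_; mk⇔; _↔_; mk↔ₛ′)
open import Relation.Binary.Definitions using (tri<; tri≈; tri>)
open import Relation.Binary.PropositionalEquality
open import Relation.Binary.PropositionalEquality.WithK using (≡-irrelevant)
open import Relation.Nullary using (¬_; Dec; yes; no; does; contradiction)
open import Relation.Nullary.Decidable using (_×-dec_; ¬?; decidable-stable)
open import Relation.Unary using (Pred; Decidable)

-- Counts are written as sums of indicators over a `box` of bounded vectors. Reversal, rotation and
-- cutting into blocks then re-index a single sum, and no bijection between subsets has to be built.
-- The bound t n loses nothing, because every vector that counts has entry sum t n - 1. The reversal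
-- is forced. Hall's condition bounds the first s i exponents from below, while L bounds initial
-- sums from above. With the total fixed, the former is an upper bound on the last s (n - i)
-- exponents, an initial segment of the reversed vector. The -1 in t n - 1 comes from the exponent t
-- - 1 of the full sum of variables, and it is what makes the good rotation unique: the partial sums
-- of kᵢ - t drop by exactly one per period, and the good rotation starts at their last maximum
-- within a period.

private variable
  A B : Set

-- Finite sums and indicators

∑ : List A → (A → ℕ) → ℕ
∑ xs f = sum (map f xs)

∑-cong : {f g : A → ℕ} → (∀ a → f a ≡ g a) → ∀ xs → ∑ xs f ≡ ∑ xs g
∑-cong f≗g xs = cong sum (Listₚ.map-cong f≗g xs)

∑-0 : (xs : List A) → ∑ xs (λ _ → 0) ≡ 0
∑-0 []       = refl
∑-0 (_ ∷ xs) = ∑-0 xs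

∑-++ : ∀ (xs ys : List A) f → ∑ (xs ++ ys) f ≡ ∑ xs f + ∑ ys f
∑-++ xs ys f = trans (cong sum (Listₚ.map-++ f xs ys)) (sum-++ (map f xs) (map f ys))

∑-+ : ∀ (xs : List A) f g → ∑ xs (λ a → f a + g a) ≡ ∑ xs f + ∑ xs g
∑-+ []       f g = refl
∑-+ (x ∷ xs) f g = trans (cong (f x + g x +_) (∑-+ xs f g)) (interchange (f x) (g x) _ _)

∑-*ˡ : ∀ (xs : List A) c f → ∑ xs (λ a → c * f a) ≡ c * ∑ xs f
∑-*ˡ []       c f = sym (*-zeroʳ c)
∑-*ˡ (x ∷ xs) c f = trans (cong (c * f x +_) (∑-*ˡ xs c f)) (sym (*-distribˡ-+ c (f x) _))

∑-const : ∀ (xs : List A) c → ∑ xs (λ _ → c) ≡ length xs * c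
∑-const []       c = refl
∑-const (_ ∷ xs) c = cong (c +_) (∑-const xs c)

∑-swap : ∀ (xs : List A) (ys : List B) (f : A → B → ℕ) →
  ∑ xs (λ a → ∑ ys (λ b → f a b)) ≡ ∑ ys (λ b → ∑ xs (λ a → f a b))
∑-swap []       ys f = sym (∑-0 ys)
∑-swap (x ∷ xs) ys f = trans (cong (∑ ys (f x) +_) (∑-swap xs ys f)) (sym (∑-+ ys (f x) _))

∑-cartesianProductWith : ∀ {C : Set} (g : A → B → C) xs ys f →
  ∑ (cartesianProductWith g xs ys) f ≡ ∑ xs (λ a → ∑ ys (λ b → f (g a b)))
∑-cartesianProductWith g []       ys f = refl
∑-cartesianProductWith g (x ∷ xs) ys f = begin
  ∑ (map (g x) ys ++ cartesianProductWith g xs ys) f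
    ≡⟨ ∑-++ (map (g x) ys) _ f ⟩
  ∑ (map (g x) ys) f + ∑ (cartesianProductWith g xs ys) f
    ≡⟨ cong₂ _+_ (cong sum (sym (Listₚ.map-∘ ys))) (∑-cartesianProductWith g xs ys f) ⟩
  ∑ ys (λ b → f (g x b)) + ∑ xs (λ a → ∑ ys (λ b → f (g a b))) ∎
  where open ≡-Reasoning

∑-upTo-suc : ∀ b f → ∑ (upTo (suc b)) f ≡ f 0 + ∑ (upTo b) (f ∘ suc)
∑-upTo-suc b f = cong (λ xs → f 0 + sum xs)
  (trans (Listₚ.map-applyUpTo suc f b) (sym (Listₚ.map-upTo (f ∘ suc) b)))

∑-upTo-last : ∀ b f → ∑ (upTo (suc b)) f ≡ ∑ (upTo b) f + f b
∑-upTo-last b f = begin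
  ∑ (upTo (suc b)) f           ≡⟨ cong (λ xs → ∑ xs f) (sym (Listₚ.upTo-∷ʳ b)) ⟩
  ∑ (upTo b List.∷ʳ b) f       ≡⟨ ∑-++ (upTo b) (b ∷ []) f ⟩
  ∑ (upTo b) f + (f b + 0)     ≡⟨ cong (∑ (upTo b) f +_) (+-identityʳ (f b)) ⟩
  ∑ (upTo b) f + f b           ∎
  where open ≡-Reasoning

∑-upTo-0 : ∀ b f → (∀ {i} → i < b → f i ≡ 0) → ∑ (upTo b) f ≡ 0
∑-upTo-0 zero    f f≡0 = refl
∑-upTo-0 (suc b) f f≡0 = trans (∑-upTo-suc b f)
  (cong₂ _+_ (f≡0 (s≤s z≤n)) (∑-upTo-0 b (f ∘ suc) (λ i<b → f≡0 (s≤s i<b))))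

∑-upTo-single : ∀ b f {r} → r < b → (∀ {i} → i < b → i ≢ r → f i ≡ 0) → ∑ (upTo b) f ≡ f r
∑-upTo-single (suc b) f {zero} _ f≡0 = trans (∑-upTo-suc b f)
  (trans (cong (f 0 +_) (∑-upTo-0 b (f ∘ suc) (λ i<b → f≡0 (s≤s i<b) (λ ())))) (+-identityʳ (f 0)))
∑-upTo-single (suc b) f {suc r} (s≤s r<b) f≡0 = trans (∑-upTo-suc b f)
  (cong₂ _+_ (f≡0 (s≤s z≤n) (λ ()))
    (∑-upTo-single b (f ∘ suc) r<b (λ i<b i≢r → f≡0 (s≤s i<b) (i≢r ∘ suc-injective))))

indicator : {P : Set} → Dec P → ℕ
indicator P? = if does P? then 1 else 0

indicator-yes : {P : Set} (P? : Dec P) → P → indicator P? ≡ 1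
indicator-yes (yes _) _ = refl
indicator-yes (no ¬p) p = contradiction p ¬p

indicator-no : {P : Set} (P? : Dec P) → ¬ P → indicator P? ≡ 0
indicator-no (yes p) ¬p = contradiction p ¬p
indicator-no (no _)  _  = refl

∑-filter : ∀ {P : Pred A _} (P? : Decidable P) xs f →
  ∑ (filter P? xs) f ≡ ∑ xs (λ a → f a * indicator (P? a))
∑-filter P? []       f = refl
∑-filter P? (x ∷ xs) f with does (P? x)
... | true  = cong₂ _+_ (sym (*-identityʳ (f x))) (∑-filter P? xs f)
... | false = trans (∑-filter P? xs f) (cong (_+ ∑ xs (λ a → f a * indicator (P? a))) (sym (*-zeroʳ (f x))))

-- Sums over a box

∑-box-∷ : ∀ n b f → ∑ (box (suc n) b) f ≡ ∑ (upTo b) (λ x → ∑ (box n b) (λ v → f (x ∷ v)))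
∑-box-∷ n b f = ∑-cartesianProductWith _∷_ (upTo b) (box n b) f

-- Exchanging the sums over the first and the last coordinate. Comparing this with `∑-box-∷` yields
-- the invariance of box sums under reversal and rotation.
∑-box-∷ʳ : ∀ n b f → ∑ (box (suc n) b) f ≡ ∑ (upTo b) (λ x → ∑ (box n b) (λ v → f (v ∷ʳ x)))
∑-box-∷ʳ zero    b f = ∑-box-∷ 0 b f
∑-box-∷ʳ (suc n) b f = begin
  ∑ (box (2 + n) b) f
    ≡⟨ ∑-box-∷ (suc n) b f ⟩
  ∑ (upTo b) (λ y → ∑ (box (suc n) b) (λ v → f (y ∷ v)))
    ≡⟨ ∑-cong (λ y → ∑-box-∷ʳ n b (λ v → f (y ∷ v))) (upTo b) ⟩
  ∑ (upTo b) (λ y → ∑ (upTo b) (λ x → ∑ (box n b) (λ v → f (y ∷ (v ∷ʳ x)))))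
    ≡⟨ ∑-swap (upTo b) (upTo b) _ ⟩
  ∑ (upTo b) (λ x → ∑ (upTo b) (λ y → ∑ (box n b) (λ v → f (y ∷ (v ∷ʳ x)))))
    ≡⟨ ∑-cong (λ x → ∑-box-∷ n b (λ v → f (v ∷ʳ x))) (upTo b) ⟨
  ∑ (upTo b) (λ x → ∑ (box (suc n) b) (λ v → f (v ∷ʳ x))) ∎
  where open ≡-Reasoning

∑-box-reverse : ∀ n b f → ∑ (box n b) (f ∘ reverse) ≡ ∑ (box n b) f
∑-box-reverse zero    b f = refl
∑-box-reverse (suc n) b f = begin
  ∑ (box (suc n) b) (f ∘ reverse)
    ≡⟨ ∑-box-∷ n b (f ∘ reverse) ⟩
  ∑ (upTo b) (λ x → ∑ (box n b) (λ v → f (reverse (x ∷ v))))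
    ≡⟨ ∑-cong (λ x → ∑-cong (λ v → cong f (Vecₚ.reverse-∷ x v)) (box n b)) (upTo b) ⟩
  ∑ (upTo b) (λ x → ∑ (box n b) (λ v → f (reverse v ∷ʳ x)))
    ≡⟨ ∑-cong (λ x → ∑-box-reverse n b (λ v → f (v ∷ʳ x))) (upTo b) ⟩
  ∑ (upTo b) (λ x → ∑ (box n b) (λ v → f (v ∷ʳ x)))
    ≡⟨ ∑-box-∷ʳ n b f ⟨
  ∑ (box (suc n) b) f ∎
  where open ≡-Reasoning

rotate : ∀ {n} → Vec A n → Vec A n
rotate []      = []
rotate (x ∷ v) = v ∷ʳ x

rotate^ : ∀ {n} → ℕ → Vec A n → Vec A n
rotate^ zero    v = v
rotate^ (suc r) v = rotate^ r (rotate v)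

∑-box-rotate^ : ∀ r n b f → ∑ (box n b) (f ∘ rotate^ r) ≡ ∑ (box n b) f
∑-box-rotate^ zero    n       b f = refl
∑-box-rotate^ (suc r) zero    b f = ∑-box-rotate^ r zero b f
∑-box-rotate^ (suc r) (suc n) b f = begin
  ∑ (box (suc n) b) (f ∘ rotate^ r ∘ rotate)
    ≡⟨ ∑-box-∷ n b (f ∘ rotate^ r ∘ rotate) ⟩
  ∑ (upTo b) (λ x → ∑ (box n b) (λ v → f (rotate^ r (v ∷ʳ x))))
    ≡⟨ ∑-box-∷ʳ n b (f ∘ rotate^ r) ⟨
  ∑ (box (suc n) b) (f ∘ rotate^ r)
    ≡⟨ ∑-box-rotate^ r (suc n) b f ⟩
  ∑ (box (suc n) b) f ∎
  where open ≡-Reasoning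

-- Vectors with prescribed sum or block sums

-- The number of vectors in ℕ^s with entry sum j. Pascal's recurrence fits the coordinatewise
-- recursion of `box` and avoids the truncated subtraction in C(j+s-1, j).
multichoose : ℕ → ℕ → ℕ
multichoose zero    zero    = 1
multichoose zero    (suc j) = 0
multichoose (suc s) zero    = multichoose s 0
multichoose (suc s) (suc j) = multichoose s (suc j) + multichoose (suc s) j

multichoose-0 : ∀ s → multichoose s 0 ≡ 1
multichoose-0 zero    = refl
multichoose-0 (suc s) = multichoose-0 s

nC0≡1 : ∀ n → n C 0 ≡ 1
nC0≡1 n = trans (nCk≡nC[n∸k] (z≤n {n})) (nCn≡1 n)

multichoose-C : ∀ s j → multichoose s j ≡ (j + s ∸ 1) C j
multichoose-C zero    zero    = refl
multichoose-C zero    (suc j) = sym (k>n⇒nCk≡0 (s≤s (≤-reflexive (+-identityʳ j))))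
multichoose-C (suc s) zero    = trans (multichoose-0 s) (sym (nC0≡1 s))
multichoose-C (suc s) (suc j) = begin
  multichoose s (suc j) + multichoose (suc s) j
    ≡⟨ cong₂ _+_ (multichoose-C s (suc j)) (multichoose-C (suc s) j) ⟩
  (j + s) C suc j + (j + suc s ∸ 1) C j
    ≡⟨ +-comm ((j + s) C suc j) _ ⟩
  (j + suc s ∸ 1) C j + (j + s) C suc j
    ≡⟨ cong (λ m → (m ∸ 1) C j + (j + s) C suc j) (+-suc j s) ⟩
  (j + s) C j + (j + s) C suc j
    ≡⟨ nCk+nC[k+1]≡[n+1]C[k+1] (j + s) j ⟩
  suc (j + s) C suc j
    ≡⟨ cong (_C suc j) (+-suc j s) ⟨
  (j + suc s) C suc j ∎
  where open ≡-Reasoning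

VanishesFrom : ℕ → (ℕ → ℕ) → Set
VanishesFrom b f = ∀ {i} → b ≤ i → f i ≡ 0

-- Collecting the pairs (x, j) by their sum m, the value f m receives `multichoose s 0` + ... +
-- `multichoose s m`, which is `multichoose (suc s) m`. The induction splits off the row x = 0 and
-- shifts f; the vanishing hypothesis removes the pairs with x + j beyond the bound.
∑-shift : ∀ s b f → VanishesFrom b f →
  ∑ (upTo b) (λ x → ∑ (upTo b) (λ j → multichoose s j * f (x + j))) ≡
  ∑ (upTo b) (λ j → multichoose (suc s) j * f j)
∑-shift s zero    f f≡0 = refl
∑-shift s (suc b) f f≡0 = begin
  ∑ (upTo (suc b)) (λ x → ∑ (upTo (suc b)) (λ j → c j * f (x + j)))
    ≡⟨ ∑-upTo-suc b _ ⟩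
  ∑ (upTo (suc b)) (λ j → c j * f j) +
  ∑ (upTo b) (λ x → ∑ (upTo (suc b)) (λ j → c j * f (suc x + j)))
    ≡⟨ cong₂ _+_ (∑-upTo-suc b _) (trans (∑-cong dropLast (upTo b)) (∑-shift s b (f ∘ suc) (f≡0 ∘ s≤s))) ⟩
  c 0 * f 0 + ∑ (upTo b) (λ j → c (suc j) * f (suc j)) + ∑ (upTo b) (λ j → multichoose (suc s) j * f (suc j))
    ≡⟨ +-assoc (c 0 * f 0) _ _ ⟩
  c 0 * f 0 + (∑ (upTo b) (λ j → c (suc j) * f (suc j)) + ∑ (upTo b) (λ j → multichoose (suc s) j * f (suc j)))
    ≡⟨ cong (c 0 * f 0 +_) (∑-+ (upTo b) _ _) ⟨
  c 0 * f 0 + ∑ (upTo b) (λ j → c (suc j) * f (suc j) + multichoose (suc s) j * f (suc j))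
    ≡⟨ cong (c 0 * f 0 +_) (∑-cong (λ j → *-distribʳ-+ (f (suc j)) (c (suc j)) _) (upTo b)) ⟨
  c 0 * f 0 + ∑ (upTo b) (λ j → multichoose (suc s) (suc j) * f (suc j))
    ≡⟨ ∑-upTo-suc b (λ j → multichoose (suc s) j * f j) ⟨
  ∑ (upTo (suc b)) (λ j → multichoose (suc s) j * f j) ∎
  where
  open ≡-Reasoning
  c = multichoose s
  dropLast : ∀ x → ∑ (upTo (suc b)) (λ j → c j * f (suc x + j)) ≡ ∑ (upTo b) (λ j → c j * f (suc (x + j)))
  dropLast x = trans (∑-upTo-last b _) (trans
    (cong (∑ (upTo b) (λ j → c j * f (suc (x + j))) +_)
      (trans (cong (c b *_) (f≡0 (s≤s (m≤n+m b x)))) (*-zeroʳ (c b))))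
    (+-identityʳ _))

∑-box-sum : ∀ s b f → VanishesFrom b f →
  ∑ (box s b) (λ v → f (sum (toList v))) ≡ ∑ (upTo b) (λ j → multichoose s j * f j)
∑-box-sum zero    zero    f f≡0 = cong (_+ 0) (f≡0 z≤n)
∑-box-sum zero    (suc b) f f≡0 = sym (begin
  ∑ (upTo (suc b)) (λ j → multichoose 0 j * f j)  ≡⟨ ∑-upTo-suc b _ ⟩
  1 * f 0 + ∑ (upTo b) (λ _ → 0)                  ≡⟨ cong₂ _+_ (*-identityˡ (f 0)) (∑-0 (upTo b)) ⟩
  f 0 + 0                                         ∎)
  where open ≡-Reasoning
∑-box-sum (suc s) b f f≡0 = begin
  ∑ (box (suc s) b) (λ v → f (sum (toList v)))
    ≡⟨ ∑-box-∷ s b _ ⟩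
  ∑ (upTo b) (λ x → ∑ (box s b) (λ v → f (x + sum (toList v))))
    ≡⟨ ∑-cong (λ x → ∑-box-sum s b (λ j → f (x + j)) (λ b≤i → f≡0 (≤-trans b≤i (m≤n+m _ x)))) (upTo b) ⟩
  ∑ (upTo b) (λ x → ∑ (upTo b) (λ j → multichoose s j * f (x + j)))
    ≡⟨ ∑-shift s b f f≡0 ⟩
  ∑ (upTo b) (λ j → multichoose (suc s) j * f j) ∎
  where open ≡-Reasoning

-- `F` takes lists, so that splitting a vector of length m + n involves no transport between vector
-- types.
∑-box-++ : ∀ m n b (F : List ℕ → ℕ) →
  ∑ (box (m + n) b) (F ∘ toList) ≡ ∑ (box m b) (λ u → ∑ (box n b) (λ v → F (toList u ++ toList v)))
∑-box-++ zero    n b F = sym (+-identityʳ _)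
∑-box-++ (suc m) n b F = begin
  ∑ (box (suc m + n) b) (F ∘ toList)
    ≡⟨ ∑-box-∷ (m + n) b _ ⟩
  ∑ (upTo b) (λ x → ∑ (box (m + n) b) (λ w → F (x ∷ toList w)))
    ≡⟨ ∑-cong (λ x → ∑-box-++ m n b (λ w → F (x ∷ w))) (upTo b) ⟩
  ∑ (upTo b) (λ x → ∑ (box m b) (λ u → ∑ (box n b) (λ v → F (x ∷ (toList u ++ toList v)))))
    ≡⟨ ∑-box-∷ m b _ ⟨
  ∑ (box (suc m) b) (λ u → ∑ (box n b) (λ v → F (toList u ++ toList v))) ∎
  where open ≡-Reasoning

blockSums : ℕ → ℕ → List ℕ → List ℕ
blockSums s zero    xs = []
blockSums s (suc n) xs = sum (take s xs) ∷ blockSums s n (drop s xs)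

take-toList-++ : ∀ {A : Set} {m} (u : Vec A m) ys → take m (toList u ++ ys) ≡ toList u
take-toList-++ []      ys = refl
take-toList-++ (x ∷ u) ys = cong (x ∷_) (take-toList-++ u ys)

drop-toList-++ : ∀ {A : Set} {m} (u : Vec A m) ys → drop m (toList u ++ ys) ≡ ys
drop-toList-++ []      ys = refl
drop-toList-++ (x ∷ u) ys = drop-toList-++ u ys

weight : ℕ → List ℕ → ℕ
weight s ks = product (map (multichoose s) ks)

-- A block with sum k arises from `multichoose s k` vectors, so `weight` is the size of the fibre of
-- `blockSums` over a list of sums. The same bound b serves both boxes because `F` vanishes on lists
-- whose sum reaches b.
∑-box-blockSums : ∀ s n b (F : List ℕ → ℕ) → (∀ xs → b ≤ sum xs → F xs ≡ 0) →
  ∑ (box (n * s) b) (F ∘ blockSums s n ∘ toList) ≡ ∑ (box n b) (λ k → weight s (toList k) * F (toList k))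
∑-box-blockSums s zero    b F F≡0 = cong (_+ 0) (sym (*-identityˡ (F [])))
∑-box-blockSums s (suc n) b F F≡0 = begin
  ∑ (box (s + n * s) b) (F ∘ blockSums s (suc n) ∘ toList)
    ≡⟨ ∑-box-++ s (n * s) b (F ∘ blockSums s (suc n)) ⟩
  ∑ (box s b) (λ u → ∑ (box (n * s) b) (λ v → F (blockSums s (suc n) (toList u ++ toList v))))
    ≡⟨ ∑-cong (λ u → ∑-cong (λ v → cong₂ (λ xs ys → F (sum xs ∷ blockSums s n ys))
         (take-toList-++ u (toList v)) (drop-toList-++ u (toList v))) (box (n * s) b)) (box s b) ⟩
  ∑ (box s b) (λ u → ∑ (box (n * s) b) (λ v → F (sum (toList u) ∷ blockSums s n (toList v))))
    ≡⟨ ∑-cong (λ u → ∑-box-blockSums s n b (λ ks → F (sum (toList u) ∷ ks))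
         (λ xs b≤ → F≡0 _ (≤-trans b≤ (m≤n+m _ (sum (toList u)))))) (box s b) ⟩
  ∑ (box s b) (λ u → ∑ (box n b) (λ k → weight s (toList k) * F (sum (toList u) ∷ toList k)))
    ≡⟨ ∑-box-sum s b (λ x → ∑ (box n b) (λ k → weight s (toList k) * F (x ∷ toList k)))
         (λ b≤x → trans (∑-cong (λ k → trans (cong (weight s (toList k) *_)
            (F≡0 _ (≤-trans b≤x (m≤m+n _ _)))) (*-zeroʳ (weight s (toList k)))) (box n b)) (∑-0 (box n b))) ⟩
  ∑ (upTo b) (λ x → multichoose s x * ∑ (box n b) (λ k → weight s (toList k) * F (x ∷ toList k)))
    ≡⟨ ∑-cong (λ x → trans (sym (∑-*ˡ (box n b) (multichoose s x) _))
         (∑-cong (λ k → sym (*-assoc (multichoose s x) _ _)) (box n b))) (upTo b) ⟩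
  ∑ (upTo b) (λ x → ∑ (box n b) (λ k → weight s (x ∷ toList k) * F (x ∷ toList k)))
    ≡⟨ ∑-box-∷ n b _ ⟨
  ∑ (box (suc n) b) (λ k → weight s (toList k) * F (toList k)) ∎
  where open ≡-Reasoning

sum-blockSums : ∀ s n xs → length xs ≡ n * s → sum (blockSums s n xs) ≡ sum xs
sum-blockSums s zero    []  _  = refl
sum-blockSums s (suc n) xs  eq = begin
  sum (take s xs) + sum (blockSums s n (drop s xs))
    ≡⟨ cong (sum (take s xs) +_) (sum-blockSums s n (drop s xs)
         (trans (Listₚ.length-drop s xs) (trans (cong (_∸ s) eq) (m+n∸m≡n s (n * s))))) ⟩
  sum (take s xs) + sum (drop s xs)   ≡⟨ sum-++ (take s xs) (drop s xs) ⟨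
  sum (take s xs ++ drop s xs)        ≡⟨ cong sum (Listₚ.take++drop≡id s xs) ⟩
  sum xs                              ∎
  where open ≡-Reasoning

-- The cycle lemma

-- Taking the last maximum rather than any maximum gives strictness to its right, which the cycle
-- lemma needs.
lastArgmax : ∀ (B : ℕ → ℕ) m →
  ∃[ r ] r ≤ m × (∀ {i} → i ≤ m → B i ≤ B r) × (∀ {i} → r < i → i ≤ m → B i < B r)
lastArgmax B zero    = 0 , z≤n , (λ { z≤n → ≤-refl }) , λ { (s≤s _) () }
lastArgmax B (suc m) with lastArgmax B m
-- The comparison is non-strict, so a tie moves the maximum to the later index.
... | r , r≤m , max , strict with B r ≤? B (suc m)
...   | yes Br≤ = suc m , ≤-refl , max′ , λ m<i i≤m → contradiction i≤m (<⇒≱ m<i)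
  where
  max′ : ∀ {i} → i ≤ suc m → B i ≤ B (suc m)
  max′ i≤ with m≤n⇒m<n∨m≡n i≤
  ... | inj₁ (s≤s i≤m) = ≤-trans (max i≤m) Br≤
  ... | inj₂ refl      = ≤-refl
...   | no Br≰ = r , m≤n⇒m≤1+n r≤m , max′ , strict′
  where
  max′ : ∀ {i} → i ≤ suc m → B i ≤ B r
  max′ i≤ with m≤n⇒m<n∨m≡n i≤
  ... | inj₁ (s≤s i≤m) = max i≤m
  ... | inj₂ refl      = <⇒≤ (≰⇒> Br≰)
  strict′ : ∀ {i} → r < i → i ≤ suc m → B i < B r
  strict′ r<i i≤ with m≤n⇒m<n∨m≡n i≤
  ... | inj₁ (s≤s i≤m) = strict r<i i≤m
  ... | inj₂ refl      = ≰⇒> Br≰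

∸1< : ∀ n .{{_ : NonZero n}} → n ∸ 1 < n
∸1< (suc n) = ≤-refl

Dominates : ℕ → (ℕ → ℕ) → ℕ → Set
Dominates n B r = ∀ i → r < i → i ≤ r + n → B i < B r

module _ {n} (B : ℕ → ℕ) (descends : ∀ i → i < n → suc (B (i + n)) ≡ B i) where

  -- The last maximum r of the first period works. An index beyond that period is one period after
  -- some index at most r, where B is larger by one and still at most B r.
  dominates-exists : 0 < n → ∃[ r ] r < n × Dominates n B r
  dominates-exists (s≤s {n = m} _) with lastArgmax B m
  ... | r , r≤m , max , strict = r , s≤s r≤m , dom
    where
    dom : Dominates n B r
    dom i r<i i≤r+n with i ≤? m
    ... | yes i≤m = strict r<i i≤m
    ... | no  i≰m = begin-strict
      B i                   ≡⟨ cong B (m∸n+n≡m (≰⇒> i≰m)) ⟨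
      B (i ∸ n + n)         <⟨ n<1+n _ ⟩
      suc (B (i ∸ n + n))   ≡⟨ descends (i ∸ n) (s≤s (≤-trans i∸n≤r r≤m)) ⟩
      B (i ∸ n)             ≤⟨ max (≤-trans i∸n≤r r≤m) ⟩
      B r                   ∎
      where
      open ≤-Reasoning
      i∸n≤r : i ∸ n ≤ r
      i∸n≤r = m≤n+o⇒m∸n≤o i n (≤-trans i≤r+n (≤-reflexive (+-comm r n)))

  -- If both dominated, B r′ < B r, while r + n lies in the window of r′ and gives B r - 1 < B r′. A
  -- drop of exactly one leaves no integer in between.
  dominates-≮ : ∀ {r r′} → r < r′ → r′ < n → Dominates n B r → ¬ Dominates n B r′
  dominates-≮ {r} {r′} r<r′ r′<n dom dom′ = <⇒≱ (dom r′ r<r′ (≤-trans (<⇒≤ r′<n) (m≤n+m n r)))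
    (subst (_≤ B r′) (descends r (<-trans r<r′ r′<n))
      (dom′ (r + n) (<-≤-trans r′<n (m≤n+m n r)) (+-monoˡ-≤ n (<⇒≤ r<r′))))

  dominates-unique : ∀ {r r′} → r < n → r′ < n → Dominates n B r → Dominates n B r′ → r ≡ r′
  dominates-unique {r} {r′} r<n r′<n dom dom′ with <-cmp r r′
  ... | tri< r<r′ _ _ = contradiction dom′ (dominates-≮ r<r′ r′<n dom)
  ... | tri≈ _ r≡r′ _ = r≡r′
  ... | tri> _ _ r′<r = contradiction dom (dominates-≮ r′<r r<n dom′)

  ∑-dominates : 0 < n → {P : ℕ → Set} (P? : Decidable P) →
    (∀ {r} → r < n → P r → Dominates n B r) → (∀ {r} → r < n → Dominates n B r → P r) →
    ∑ (upTo n) (λ r → indicator (P? r)) ≡ 1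
  ∑-dominates 0<n P? P⇒dom dom⇒P with dominates-exists 0<n
  ... | r , r<n , dom = trans
    (∑-upTo-single n _ r<n λ i<n i≢r →
      indicator-no (P? _) λ p → i≢r (dominates-unique i<n r<n (P⇒dom i<n p) dom))
    (indicator-yes (P? r) (dom⇒P r<n dom))

-- Prefix sums

prefixSum : ℕ → List ℕ → ℕ
prefixSum j xs = sum (take j xs)

prefixSum-++ : ∀ {j} xs ys → j ≤ length xs → prefixSum j (xs ++ ys) ≡ prefixSum j xs
prefixSum-++ {zero}  xs       ys _         = refl
prefixSum-++ {suc j} (x ∷ xs) ys (s≤s j≤) = cong (x +_) (prefixSum-++ xs ys j≤)

prefixSum-all : ∀ {j} xs → length xs ≤ j → prefixSum j xs ≡ sum xs
prefixSum-all {j} xs ≤j = cong sum (Listₚ.take-all j xs ≤j)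

toList-rotate : ∀ {A : Set} {n} (v : Vec A n) → toList (rotate v) ↭ toList v
toList-rotate []      = ↭-refl
toList-rotate (x ∷ v) = subst (_↭ x ∷ toList v) (sym (Vecₚ.toList-∷ʳ x v)) (++-comm (toList v) (x ∷ []))

toList-rotate^ : ∀ {A : Set} {n} r (v : Vec A n) → toList (rotate^ r v) ↭ toList v
toList-rotate^ zero    v = ↭-refl
toList-rotate^ (suc r) v = ↭-trans (toList-rotate^ r (rotate v)) (toList-rotate v)

-- The partial sums of the periodic sequence with period v.
cyclicSum : ∀ {n} → Vec ℕ (suc n) → ℕ → ℕ
cyclicSum v zero    = 0
cyclicSum v (suc i) = head v + cyclicSum (rotate v) i

cyclicSum-+ : ∀ {n} r j (v : Vec ℕ (suc n)) →
  cyclicSum v (r + j) ≡ cyclicSum v r + cyclicSum (rotate^ r v) j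
cyclicSum-+ zero    j v = refl
cyclicSum-+ (suc r) j v = trans (cong (head v +_) (cyclicSum-+ r j (rotate v))) (sym (+-assoc (head v) _ _))

-- Rotating puts the head behind the remaining entries, out of reach of the prefix still to be
-- summed.
prefixSum-cyclicSum : ∀ {n} j (v : Vec ℕ (suc n)) → j ≤ suc n → prefixSum j (toList v) ≡ cyclicSum v j
prefixSum-cyclicSum zero    v       _        = refl
prefixSum-cyclicSum (suc j) (x ∷ v) (s≤s j≤) = cong (x +_) (begin
  prefixSum j (toList v)
    ≡⟨ prefixSum-++ (toList v) (x ∷ []) (≤-trans j≤ (≤-reflexive (sym (Vecₚ.length-toList v)))) ⟨
  prefixSum j (toList v ++ x ∷ [])
    ≡⟨ cong (prefixSum j) (Vecₚ.toList-∷ʳ x v) ⟨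
  prefixSum j (toList (v ∷ʳ x))
    ≡⟨ prefixSum-cyclicSum j (v ∷ʳ x) (m≤n⇒m≤1+n j≤) ⟩
  cyclicSum (v ∷ʳ x) j ∎)
  where open ≡-Reasoning

-- The cycle lemma for rotations lying in L

module _ {m} (t : ℕ) .{{_ : NonZero t}} (v : Vec ℕ (suc m)) where

  private
    n = suc m

    -- The partial sums of the sequence vᵢ - t, shifted by 2 n t to make them natural numbers.
    potential : ℕ → ℕ
    potential i = cyclicSum v i + t * (n + n ∸ i)

    -- Arranged to share its outer terms with `potential-shift`: comparing the potentials at r and r
    -- + j amounts to comparing t * j with the sum of the first j entries of the r-fold rotation.
    potential-+ : ∀ r j → r + j ≤ n + n →
      potential r ≡ cyclicSum v r + (t * j + t * (n + n ∸ (r + j)))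
    potential-+ r j r+j≤ = cong (cyclicSum v r +_) (begin
      t * (n + n ∸ r)                     ≡⟨ cong (t *_) (m+[n∸m]≡n (j≤ r+j≤)) ⟨
      t * (j + (n + n ∸ r ∸ j))           ≡⟨ cong (λ k → t * (j + k)) (∸-+-assoc (n + n) r j) ⟩
      t * (j + (n + n ∸ (r + j)))         ≡⟨ *-distribˡ-+ t j _ ⟩
      t * j + t * (n + n ∸ (r + j))       ∎)
      where
      open ≡-Reasoning
      j≤ : r + j ≤ n + n → j ≤ n + n ∸ r
      j≤ p = subst (_≤ n + n ∸ r) (m+n∸m≡n r j) (∸-monoˡ-≤ r p)

    potential-shift : ∀ r j →
      potential (r + j) ≡ cyclicSum v r + (cyclicSum (rotate^ r v) j + t * (n + n ∸ (r + j)))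
    potential-shift r j = trans (cong (_+ t * (n + n ∸ (r + j))) (cyclicSum-+ r j v)) (+-assoc (cyclicSum v r) _ _)

  module _ (sum≡ : sum (toList v) ≡ t * n ∸ 1) where
    private
      sum-rotate^ : ∀ r → sum (toList (rotate^ r v)) ≡ t * n ∸ 1
      sum-rotate^ r = trans (sum-↭ (toList-rotate^ r v)) sum≡

      -- Over one period the entries contribute t n - 1 and the linear term loses t n.
      descends : ∀ i → i < n → suc (potential (i + n)) ≡ potential i
      descends i i<n = begin
        suc (potential (i + n))
          ≡⟨ cong suc (potential-shift i n) ⟩
        suc (cyclicSum v i + (cyclicSum (rotate^ i v) n + rest))
          ≡⟨ +-suc (cyclicSum v i) _ ⟨
        cyclicSum v i + (suc (cyclicSum (rotate^ i v) n) + rest)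
          ≡⟨ cong (λ a → cyclicSum v i + (suc a + rest)) (trans (sym (prefixSum-cyclicSum n (rotate^ i v) ≤-refl))
               (trans (prefixSum-all (toList (rotate^ i v)) (≤-reflexive (Vecₚ.length-toList (rotate^ i v)))) (sum-rotate^ i))) ⟩
        cyclicSum v i + (suc (t * n ∸ 1) + rest)
          ≡⟨ cong (λ a → cyclicSum v i + (a + rest)) (m+[n∸m]≡n (>-nonZero⁻¹ (t * n) {{m*n≢0 t n}})) ⟩
        cyclicSum v i + (t * n + rest)
          ≡⟨ potential-+ i n (+-monoˡ-≤ n (<⇒≤ i<n)) ⟨
        potential i ∎
        where
        open ≡-Reasoning
        rest = t * (n + n ∸ (i + n))

      ∈L⇒dominates : ∀ {r} → r < n → rotate^ r v ∈L t → Dominates n potential r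
      ∈L⇒dominates {r} r<n (below , _) i r<i i≤r+n with m≤n⇒∃[o]m+o≡n r<i
      ... | j , refl = begin-strict
        potential (suc r + j)
          ≡⟨ cong potential (+-suc r j) ⟨
        potential (r + suc j)
          ≡⟨ potential-shift r (suc j) ⟩
        cyclicSum v r + (cyclicSum (rotate^ r v) (suc j) + t * (n + n ∸ (r + suc j)))
          <⟨ +-monoʳ-< (cyclicSum v r) (+-monoˡ-< _ cyclicSum<) ⟩
        cyclicSum v r + (t * suc j + t * (n + n ∸ (r + suc j)))
          ≡⟨ potential-+ r (suc j) (+-mono-≤ (<⇒≤ r<n) j<n) ⟨
        potential r ∎
        where
        open ≤-Reasoning
        j<n : j < n
        j<n = +-cancelˡ-≤ r (suc j) n (subst (_≤ r + n) (sym (+-suc r j)) i≤r+n)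
        cyclicSum< : cyclicSum (rotate^ r v) (suc j) < t * suc j
        cyclicSum< = begin-strict
          cyclicSum (rotate^ r v) (suc j)          ≡⟨ prefixSum-cyclicSum (suc j) (rotate^ r v) j<n ⟨
          prefixSum (suc j) (toList (rotate^ r v)) ≤⟨ subst (λ k → prefixSum (suc k) (toList (rotate^ r v)) ≤ t * suc k ∸ 1)
                                                        (toℕ-fromℕ< j<n) (below (fromℕ< j<n)) ⟩
          t * suc j ∸ 1                            <⟨ ∸1< (t * suc j) {{m*n≢0 t (suc j)}} ⟩
          t * suc j                                ∎

      dominates⇒∈L : ∀ {r} → r < n → Dominates n potential r → rotate^ r v ∈L t
      dominates⇒∈L {r} r<n dom = below , sum-rotate^ r
        where
        open ≤-Reasoning
        below : ∀ j → prefixSum (suc (toℕ j)) (toList (rotate^ r v)) ≤ t * suc (toℕ j) ∸ 1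
        -- Cancelling the common terms leaves a strict inequality against t * k; passing to
        -- predecessors turns it into the bound `t * k ∸ 1` of L.
        below j = ∸-monoˡ-≤ 1 (+-cancelʳ-< _ _ _ (+-cancelˡ-< (cyclicSum v r) _ _ (begin-strict
          cyclicSum v r + (prefixSum k (toList (rotate^ r v)) + t * (n + n ∸ (r + k)))
            ≡⟨ cong (λ a → cyclicSum v r + (a + t * (n + n ∸ (r + k)))) (prefixSum-cyclicSum k (rotate^ r v) (toℕ<n j)) ⟩
          cyclicSum v r + (cyclicSum (rotate^ r v) k + t * (n + n ∸ (r + k)))
            ≡⟨ potential-shift r k ⟨
          potential (r + k)
            <⟨ dom (r + k) (m<m+n r (s≤s z≤n)) (+-monoʳ-≤ r (toℕ<n j)) ⟩
          potential r
            ≡⟨ potential-+ r k (+-mono-≤ (<⇒≤ r<n) (toℕ<n j)) ⟩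
          cyclicSum v r + (t * k + t * (n + n ∸ (r + k))) ∎)))
          where k = suc (toℕ j)

    ∑-rotations-∈L : ∑ (upTo n) (λ r → indicator (∈L? t (rotate^ r v))) ≡ 1
    ∑-rotations-∈L = ∑-dominates potential descends (s≤s z≤n) (λ r → ∈L? t (rotate^ r v)) ∈L⇒dominates dominates⇒∈L

-- The closed formula for the sum over L

product-map-rotate^ : ∀ {n} (f : ℕ → ℕ) r (v : Vec ℕ n) →
  product (map f (toList (rotate^ r v))) ≡ product (map f (toList v))
product-map-rotate^ f r v = product-↭ (↭-map⁺ f (toList-rotate^ r v))

sumOverL-weight : ∀ n s t →
  sumOverL n s t ≡ ∑ (box n (t * n)) (λ k → weight s (toList k) * indicator (∈L? t k))
sumOverL-weight n s t = trans
  (∑-cong (λ k → cong product (Listₚ.map-cong (λ j → sym (multichoose-C s j)) (toList k))) (L n t))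
  (∑-filter (∈L? t) (box n (t * n)) _)

-- Double counting: n copies of the box sum are re-indexed by the n different rotations. After
-- exchanging the sums, each k contributes its weight times the number of its rotations in L, which
-- is one if its entries sum to t n - 1 and zero otherwise.
n*sumOverL : ∀ n s t .{{_ : NonZero n}} .{{_ : NonZero t}} →
  n * sumOverL n s t ≡ multichoose (n * s) (t * n ∸ 1)
n*sumOverL n@(suc _) s t = begin
  n * sumOverL n s t
    ≡⟨ cong (n *_) (sumOverL-weight n s t) ⟩
  n * ∑ (box n b) f
    ≡⟨ cong (_* ∑ (box n b) f) (Listₚ.length-upTo n) ⟨
  length (upTo n) * ∑ (box n b) f
    ≡⟨ ∑-const (upTo n) _ ⟨
  ∑ (upTo n) (λ _ → ∑ (box n b) f)
    ≡⟨ ∑-cong (λ r → sym (∑-box-rotate^ r n b f)) (upTo n) ⟩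
  ∑ (upTo n) (λ r → ∑ (box n b) (f ∘ rotate^ r))
    ≡⟨ ∑-swap (upTo n) (box n b) _ ⟩
  ∑ (box n b) (λ k → ∑ (upTo n) (λ r → f (rotate^ r k)))
    ≡⟨ ∑-cong overRotations (box n b) ⟩
  ∑ (box n b) (λ k → weight s (toList k) * F (toList k))
    -- Read backwards: the weights are expanded into vectors of length n s, on which only the total
    -- matters.
    ≡⟨ ∑-box-blockSums s n b F F≡0 ⟨
  ∑ (box (n * s) b) (F ∘ blockSums s n ∘ toList)
    ≡⟨ ∑-cong (λ e → cong (λ m → indicator (m ≟ b ∸ 1))
         (sum-blockSums s n (toList e) (Vecₚ.length-toList e))) (box (n * s) b) ⟩
  ∑ (box (n * s) b) (F ∘ toList)
    ≡⟨ ∑-box-sum (n * s) b (λ j → indicator (j ≟ b ∸ 1)) (λ b≤i → F≡0′ b≤i) ⟩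
  ∑ (upTo b) (λ j → multichoose (n * s) j * indicator (j ≟ b ∸ 1))
    ≡⟨ ∑-upTo-single b _ b∸1<b (λ {i} _ i≢ → trans
         (cong (multichoose (n * s) i *_) (indicator-no (i ≟ b ∸ 1) i≢)) (*-zeroʳ (multichoose (n * s) i))) ⟩
  multichoose (n * s) (b ∸ 1) * indicator (b ∸ 1 ≟ b ∸ 1)
    ≡⟨ cong (multichoose (n * s) (b ∸ 1) *_) (indicator-yes (b ∸ 1 ≟ b ∸ 1) refl) ⟩
  multichoose (n * s) (b ∸ 1) * 1
    ≡⟨ *-identityʳ _ ⟩
  multichoose (n * s) (b ∸ 1) ∎
  where
  open ≡-Reasoning
  b = t * n
  b∸1<b : b ∸ 1 < b
  b∸1<b = ∸1< b {{m*n≢0 t n}}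
  f : Vec ℕ n → ℕ
  f k = weight s (toList k) * indicator (∈L? t k)
  F : List ℕ → ℕ
  F xs = indicator (sum xs ≟ b ∸ 1)
  F≡0′ : VanishesFrom b (λ j → indicator (j ≟ b ∸ 1))
  F≡0′ {i} b≤i = indicator-no (i ≟ b ∸ 1) (λ i≡ → <⇒≱ b∸1<b (subst (b ≤_) i≡ b≤i))
  F≡0 : ∀ xs → b ≤ sum xs → F xs ≡ 0
  F≡0 xs = F≡0′
  overRotations : ∀ k → ∑ (upTo n) (λ r → f (rotate^ r k)) ≡ weight s (toList k) * F (toList k)
  overRotations k = trans
    (∑-cong (λ r → cong (_* indicator (∈L? t (rotate^ r k))) (product-map-rotate^ (multichoose s) r k)) (upTo n))
    (trans (∑-*ˡ (upTo n) (weight s (toList k)) _) (cong (weight s (toList k) *_) count))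
    where
    count : ∑ (upTo n) (λ r → indicator (∈L? t (rotate^ r k))) ≡ F (toList k)
    count = case sum (toList k) ≟ b ∸ 1 of λ where
      (yes sum≡) → trans (∑-rotations-∈L t k sum≡) (sym (indicator-yes (sum (toList k) ≟ b ∸ 1) sum≡))
      (no  sum≢) → trans
        (∑-upTo-0 n _ λ {r} _ → indicator-no (∈L? t (rotate^ r k))
          λ (_ , sum≡) → sum≢ (trans (sym (sum-↭ (toList-rotate^ r k))) sum≡))
        (sym (indicator-no (sum (toList k) ≟ b ∸ 1) sum≢))

-- Duplicate-free lists; prefix sums under cutting and reversal

length-filter-∑ : ∀ {A : Set} {P : Pred A _} (P? : Decidable P) xs →
  length (filter P? xs) ≡ ∑ xs (λ a → indicator (P? a))
length-filter-∑ P? []       = refl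
length-filter-∑ P? (x ∷ xs) with does (P? x)
... | true  = cong suc (length-filter-∑ P? xs)
... | false = length-filter-∑ P? xs

-- Lets the deduplicated list of exponents behind `N` be compared with a filtered box, although the
-- two are ordered differently.
unique-length : ∀ {A : Set} {xs ys : List A} → Unique xs → Unique ys →
  (∀ {a} → a ∈ xs ⇔ a ∈ ys) → length xs ≡ length ys
unique-length xs! ys! xs≈ys = ↭-length (∼bag⇒↭ (unique∧set⇒bag xs! ys! xs≈ys))

box-! : ∀ n b → Unique (box n b)
box-! zero    b = [] ∷ []
box-! (suc n) b = Uniqueₚ.cartesianProductWith⁺ _∷_ (λ where refl → refl , refl) (Uniqueₚ.upTo⁺ b) (box-! n b)

∈-box : ∀ {n b} (v : Vec ℕ n) → sum (toList v) < b → v ∈ box n b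
∈-box []      _   = here refl
∈-box (x ∷ v) x+∑<b = ∈-cartesianProductWith⁺ _∷_
  (∈-upTo⁺ (≤-<-trans (m≤m+n x _) x+∑<b)) (∈-box v (≤-<-trans (m≤n+m _ x) x+∑<b))

prefixSum-+ : ∀ i j xs → prefixSum (i + j) xs ≡ prefixSum i xs + prefixSum j (drop i xs)
prefixSum-+ zero    j xs       = refl
prefixSum-+ (suc i) j []       = sym (cong sum (Listₚ.take-[] j))
prefixSum-+ (suc i) j (x ∷ xs) = trans (cong (x +_) (prefixSum-+ i j xs)) (sym (+-assoc x _ _))

prefixSum-mono : ∀ {i j} xs → i ≤ j → prefixSum i xs ≤ prefixSum j xs
prefixSum-mono {i} xs i≤j with m≤n⇒∃[o]m+o≡n i≤j
... | o , refl = ≤-trans (m≤m+n _ _) (≤-reflexive (sym (prefixSum-+ i o xs)))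

prefixSum-≤-sum : ∀ i xs → prefixSum i xs ≤ sum xs
prefixSum-≤-sum i xs = begin
  prefixSum i xs                  ≤⟨ m≤m+n _ _ ⟩
  prefixSum i xs + sum (drop i xs) ≡⟨ sum-++ (take i xs) (drop i xs) ⟨
  sum (take i xs ++ drop i xs)    ≡⟨ cong sum (Listₚ.take++drop≡id i xs) ⟩
  sum xs                          ∎
  where open ≤-Reasoning

-- The first i entries of the reversed list are the last i of the original, the complement of its
-- first j.
prefixSum-reverse : ∀ {i j} xs → i + j ≡ length xs →
  prefixSum i (List.reverse xs) + prefixSum j xs ≡ sum xs
prefixSum-reverse {i} {j} xs i+j≡ = begin
  prefixSum i (List.reverse xs) + sum ys
    ≡⟨ cong (λ ws → prefixSum i (List.reverse ws) + sum ys) (Listₚ.take++drop≡id j xs) ⟨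
  prefixSum i (List.reverse (ys ++ zs)) + sum ys
    ≡⟨ cong (λ ws → prefixSum i ws + sum ys) (Listₚ.reverse-++ ys zs) ⟩
  prefixSum i (List.reverse zs ++ List.reverse ys) + sum ys
    ≡⟨ cong (_+ sum ys) (prefixSum-++ (List.reverse zs) (List.reverse ys) (≤-reflexive (sym length≡))) ⟩
  prefixSum i (List.reverse zs) + sum ys
    ≡⟨ cong (_+ sum ys) (prefixSum-all (List.reverse zs) (≤-reflexive length≡)) ⟩
  sum (List.reverse zs) + sum ys
    ≡⟨ cong (_+ sum ys) (sum-↭ (↭-reverse zs)) ⟩
  sum zs + sum ys
    ≡⟨ +-comm (sum zs) (sum ys) ⟩
  sum ys + sum zs
    ≡⟨ sum-++ ys zs ⟨
  sum (ys ++ zs)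
    ≡⟨ cong sum (Listₚ.take++drop≡id j xs) ⟩
  sum xs ∎
  where
  open ≡-Reasoning
  ys = take j xs
  zs = drop j xs
  length≡ : length (List.reverse zs) ≡ i
  length≡ = trans (Listₚ.length-reverse zs) (trans (Listₚ.length-drop j xs)
    (trans (cong (_∸ j) (sym i+j≡)) (m+n∸n≡m i j)))

prefixSum-blockSums : ∀ s {n j} xs → j ≤ n → prefixSum j (blockSums s n xs) ≡ prefixSum (j * s) xs
prefixSum-blockSums s {j = zero}  xs _         = refl
prefixSum-blockSums s {j = suc j} xs (s≤s j≤n) = trans
  (cong (prefixSum s xs +_) (prefixSum-blockSums s (drop s xs) j≤n))
  (sym (prefixSum-+ s (j * s) xs))

-- Supports of polynomials all of whose terms have coefficient 1

infixl 6 _⊕_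
_⊕_ : ∀ {m} → Exponent m → Exponent m → Exponent m
_⊕_ = zipWith _+_

prefixSum-⊕ : ∀ {m} i (d e : Exponent m) →
  prefixSum i (toList (d ⊕ e)) ≡ prefixSum i (toList d) + prefixSum i (toList e)
prefixSum-⊕ zero    d       e       = refl
prefixSum-⊕ (suc i) []      []      = refl
prefixSum-⊕ (suc i) (x ∷ d) (y ∷ e) =
  trans (cong (x + y +_) (prefixSum-⊕ i d e)) (interchange x y _ _)

sum-⊕ : ∀ {m} (d e : Exponent m) → sum (toList (d ⊕ e)) ≡ sum (toList d) + sum (toList e)
sum-⊕ {m} d e = begin
  sum (toList (d ⊕ e))                                     ≡⟨ all (d ⊕ e) ⟨
  prefixSum m (toList (d ⊕ e))                             ≡⟨ prefixSum-⊕ m d e ⟩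
  prefixSum m (toList d) + prefixSum m (toList e)          ≡⟨ cong₂ _+_ (all d) (all e) ⟩
  sum (toList d) + sum (toList e)                          ∎
  where
  open ≡-Reasoning
  all : ∀ d → prefixSum m (toList d) ≡ sum (toList d)
  all d = prefixSum-all (toList d) (≤-reflexive (Vecₚ.length-toList d))

0ᵉ : ∀ {m} → Exponent m
0ᵉ {m} = Vec.replicate m 0

⊕-identityʳ : ∀ {m} (d : Exponent m) → d ⊕ 0ᵉ ≡ d
⊕-identityʳ = Vecₚ.zipWith-identityʳ +-identityʳ

⊕-identityˡ : ∀ {m} (d : Exponent m) → 0ᵉ ⊕ d ≡ d
⊕-identityˡ = Vecₚ.zipWith-identityˡ +-identityˡ

⊕-comm : ∀ {m} (d e : Exponent m) → d ⊕ e ≡ e ⊕ d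
⊕-comm = Vecₚ.zipWith-comm +-comm

⊕-assoc : ∀ {m} (d e f : Exponent m) → d ⊕ e ⊕ f ≡ d ⊕ (e ⊕ f)
⊕-assoc = Vecₚ.zipWith-assoc +-assoc

sum≡0⇒0ᵉ : ∀ {m} (d : Exponent m) → sum (toList d) ≡ 0 → d ≡ 0ᵉ
sum≡0⇒0ᵉ []      _  = refl
sum≡0⇒0ᵉ (x ∷ d) eq = cong₂ _∷_ (m+n≡0⇒m≡0 x eq) (sum≡0⇒0ᵉ d (m+n≡0⇒n≡0 x eq))

sum-0ᵉ : ∀ m → sum (toList (0ᵉ {m})) ≡ 0
sum-0ᵉ zero    = refl
sum-0ᵉ (suc m) = sum-0ᵉ m

AllOnes : ∀ {m} → Poly m → Set
AllOnes p = ∀ {c e} → (c , e) ∈ p → c ≡ 1ℤ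

Occurs : ∀ {m} → Poly m → Exponent m → Set
Occurs p e = (1ℤ , e) ∈ p

coeff≢0⇒occurs : ∀ {m} {p : Poly m} {e} → AllOnes p → coeff p e ≢ 0ℤ → Occurs p e
coeff≢0⇒occurs {p = []}          allOnes ≢0 = contradiction refl ≢0
coeff≢0⇒occurs {p = (c , d) ∷ p} {e} allOnes ≢0 with d ≟ᵉ e
... | yes refl = here (cong (_, d) (sym (allOnes (here refl))))
... | no  _    = there (coeff≢0⇒occurs (allOnes ∘ there) ≢0)

-- With all term coefficients equal to 1, `coeff p e` is the number of terms with exponent e.
coeff-nonneg : ∀ {m} {p : Poly m} → AllOnes p → ∀ e → ∃[ k ] coeff p e ≡ ℤ.+ k
coeff-nonneg {p = []}          allOnes e = 0 , refl
coeff-nonneg {p = (c , d) ∷ p} allOnes e with d ≟ᵉ e | coeff-nonneg (allOnes ∘ there) e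
... | yes _ | k , eq = suc k , cong₂ ℤ._+_ (allOnes (here refl)) eq
... | no  _ | k , eq = k , eq

occurs⇒coeff-pos : ∀ {m} {p : Poly m} {e} → AllOnes p → Occurs p e → ∃[ k ] coeff p e ≡ ℤ.+ suc k
occurs⇒coeff-pos {p = (c , d) ∷ p} {e} allOnes (here refl) with d ≟ᵉ e
... | yes _   = let k , eq = coeff-nonneg (allOnes ∘ there) e in k , cong (λ z → c ℤ.+ z) eq
... | no  d≢d = contradiction refl d≢d
occurs⇒coeff-pos {p = (c , d) ∷ p} {e} allOnes (there e∈p) with d ≟ᵉ e | occurs⇒coeff-pos (allOnes ∘ there) e∈p
... | yes _ | k , eq = suc k , cong₂ ℤ._+_ (allOnes (here refl)) eq
... | no  _ | k , eq = k , eq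

occurs⇒coeff≢0 : ∀ {m} {p : Poly m} {e} → AllOnes p → Occurs p e → coeff p e ≢ 0ℤ
occurs⇒coeff≢0 allOnes e∈p ≡0 with occurs⇒coeff-pos allOnes e∈p
... | k , eq with trans (sym eq) ≡0
... | ()

allOnes-1 : ∀ {m} → AllOnes {m} 1ᴾ
allOnes-1 (here refl) = refl

allOnes-* : ∀ {m} {p q : Poly m} → AllOnes p → AllOnes q → AllOnes (p *ᴾ q)
allOnes-* {p = p} {q} allOnes-p allOnes-q c∈ with ∈-cartesianProductWith⁻ _ p q c∈
... | _ , _ , a∈ , b∈ , refl = cong₂ ℤ._*_ (allOnes-p a∈) (allOnes-q b∈)

allOnes-^ : ∀ {m} {p : Poly m} k → AllOnes p → AllOnes (p ^ᴾ k)
allOnes-^ zero    allOnes = allOnes-1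
allOnes-^ {p = p} (suc k) allOnes = allOnes-* {p = p} allOnes (allOnes-^ k allOnes)

occurs-1 : ∀ {m} {e : Exponent m} → Occurs 1ᴾ e → e ≡ 0ᵉ
occurs-1 (here refl) = refl

occurs-*⁺ : ∀ {m} {p q : Poly m} {d e} → Occurs p d → Occurs q e → Occurs (p *ᴾ q) (d ⊕ e)
occurs-*⁺ = ∈-cartesianProductWith⁺ _

occurs-*⁻ : ∀ {m} {p q : Poly m} {f} → AllOnes p → AllOnes q → Occurs (p *ᴾ q) f →
  ∃[ d ] ∃[ e ] Occurs p d × Occurs q e × f ≡ d ⊕ e
occurs-*⁻ {p = p} {q} allOnes-p allOnes-q f∈ with ∈-cartesianProductWith⁻ _ p q f∈
... | (a , d) , (b , e) , a∈ , b∈ , eq with allOnes-p a∈ | allOnes-q b∈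
... | refl | refl = d , e , a∈ , b∈ , cong proj₂ eq

unit : ∀ {m} → Fin m → Exponent m
unit {m} i = Vec.replicate m 0 [ i ]≔ 1

sum-unit : ∀ {m} (i : Fin m) → sum (toList (unit i)) ≡ 1
sum-unit {suc m} Fin.zero    = cong suc (sum-0ᵉ m)
sum-unit {suc m} (Fin.suc i) = sum-unit i

prefixSum-unit : ∀ {m} (i : Fin m) {k} → toℕ i < k → prefixSum k (toList (unit i)) ≡ 1
prefixSum-unit {suc m} Fin.zero    {suc k} _ =
  cong suc (n≤0⇒n≡0 (subst (prefixSum k (toList (0ᵉ {m})) ≤_) (sum-0ᵉ m) (prefixSum-≤-sum k _)))
prefixSum-unit {suc m} (Fin.suc i) {suc k} (s≤s i<k) = prefixSum-unit i i<k

removeUnit : ∀ {m} k (e : Exponent m) → 0 < prefixSum k (toList e) →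
  ∃[ i ] toℕ i < k × ∃[ e′ ] e ≡ unit i ⊕ e′
removeUnit zero    e       ()
removeUnit (suc k) []      ()
removeUnit (suc k) (suc x ∷ e) _ = Fin.zero , s≤s z≤n , x ∷ e , cong (suc x ∷_) (sym (⊕-identityˡ e))
removeUnit (suc k) (zero  ∷ e) 0< with removeUnit k e 0<
... | i , i<k , e′ , eq = Fin.suc i , s≤s i<k , 0 ∷ e′ , cong (0 ∷_) eq

∈-sumVars⁺ : ∀ {m k} (i : Fin m) → toℕ i < k → Occurs (sumVars k) (unit i)
∈-sumVars⁺ i i<k = ∈-concat⁺′ (here refl) (∈-map⁺ x (∈-filter⁺ _ (∈-allFin i) i<k))

∈-sumVars⁻ : ∀ {m k c} {e : Exponent m} → (c , e) ∈ sumVars k →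
  c ≡ 1ℤ × ∃[ i ] toℕ i < k × e ≡ unit i
∈-sumVars⁻ {m} {k} c∈ with ∈-concat⁻′ (map x (filter (λ i → toℕ i <? k) (allFin m))) c∈
... | _ , c∈x , x∈ with ∈-map⁻ x x∈
... | i , i∈ , refl with c∈x
... | here refl = refl , i , proj₂ (∈-filter⁻ (λ i → toℕ i <? k) {xs = allFin m} i∈) , refl

allOnes-sumVars : ∀ {m} k → AllOnes {m} (sumVars k)
allOnes-sumVars k c∈ = proj₁ (∈-sumVars⁻ {k = k} c∈)

-- That both quantities equal a says that the whole degree sits on the first k variables.
sumVars^-occurs⁻ : ∀ {m} k a {d : Exponent m} → Occurs (sumVars k ^ᴾ a) d →
  prefixSum k (toList d) ≡ a × sum (toList d) ≡ a
sumVars^-occurs⁻ {m} k zero d∈ with occurs-1 d∈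
... | refl = n≤0⇒n≡0 (subst (prefixSum k (toList (0ᵉ {m})) ≤_) (sum-0ᵉ m) (prefixSum-≤-sum k _)) , sum-0ᵉ m
sumVars^-occurs⁻ {m} k (suc a) d∈ with occurs-*⁻ {p = sumVars k} (allOnes-sumVars k) (allOnes-^ a (allOnes-sumVars k)) d∈
... | u , d′ , u∈ , d′∈ , refl with ∈-sumVars⁻ {k = k} u∈ | sumVars^-occurs⁻ k a d′∈
... | _ , i , i<k , refl | prefix≡ , sum≡ =
  trans (prefixSum-⊕ k (unit i) d′) (cong₂ _+_ (prefixSum-unit i i<k) prefix≡) ,
  trans (sum-⊕ (unit i) d′) (cong₂ _+_ (sum-unit i) sum≡)

sumVars^-extract : ∀ {m} k a (e : Exponent m) → a ≤ prefixSum k (toList e) →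
  ∃[ d ] ∃[ e′ ] Occurs (sumVars k ^ᴾ a) d × e ≡ d ⊕ e′
sumVars^-extract k zero    e _  = 0ᵉ , e , here refl , sym (⊕-identityˡ e)
sumVars^-extract k (suc a) e a< with removeUnit k e (≤-trans (s≤s z≤n) a<)
... | i , i<k , e₁ , refl
  with sumVars^-extract k a e₁ (s≤s⁻¹ (subst (suc a ≤_)
         (trans (prefixSum-⊕ k (unit i) e₁) (cong (_+ _) (prefixSum-unit i i<k))) a<))
... | d , e′ , d∈ , refl =
  unit i ⊕ d , e′ , occurs-*⁺ {p = sumVars k} (∈-sumVars⁺ i i<k) d∈ , sym (⊕-assoc (unit i) d e′)

-- Hall's condition for the supports of the products

-- The bounds s, 2s, 3s, ... are abstracted to `κ`, so that removing the first factor is composition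
-- with `suc` and induction on r goes through.
powerProduct : ∀ {m} → (ℕ → ℕ) → ℕ → ℕ → Poly m
powerProduct κ t r = foldr _*ᴾ_ 1ᴾ (applyUpTo (λ j → sumVars (κ j) ^ᴾ t) r)

allOnes-powerProduct : ∀ {m} κ t r → AllOnes {m} (powerProduct κ t r)
allOnes-powerProduct κ t zero    = allOnes-1
allOnes-powerProduct κ t (suc r) = allOnes-* {p = sumVars (κ 0) ^ᴾ t} (allOnes-^ t (allOnes-sumVars (κ 0))) (allOnes-powerProduct (κ ∘ suc) t r)

Monotone : (ℕ → ℕ) → Set
Monotone κ = ∀ {i j} → i ≤ j → κ i ≤ κ j

-- The first i + 1 factors draw only on variables below κ i, as `κ` is monotone, and each of them
-- contributes t there.
powerProduct-occurs⁻ : ∀ {m} κ t r → Monotone κ → {d : Exponent m} → Occurs (powerProduct κ t r) d →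
  (∀ i → i < r → suc i * t ≤ prefixSum (κ i) (toList d)) × sum (toList d) ≡ r * t
powerProduct-occurs⁻ {m} κ t zero mono d∈ with occurs-1 d∈
... | refl = (λ _ ()) , sum-0ᵉ m
powerProduct-occurs⁻ κ t (suc r) mono d∈
  with occurs-*⁻ {p = sumVars (κ 0) ^ᴾ t} (allOnes-^ t (allOnes-sumVars (κ 0))) (allOnes-powerProduct (κ ∘ suc) t r) d∈
... | d₁ , d₂ , d₁∈ , d₂∈ , refl with sumVars^-occurs⁻ (κ 0) t d₁∈ | powerProduct-occurs⁻ (κ ∘ suc) t r (mono ∘ s≤s) d₂∈
... | prefix≡ , sum≡ | prefix≥ , sum≡′ = prefix≥′ , trans (sum-⊕ d₁ d₂) (cong₂ _+_ sum≡ sum≡′)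
  where
  open ≤-Reasoning
  tail≥ : ∀ i → i < suc r → i * t ≤ prefixSum (κ i) (toList d₂)
  tail≥ zero    _         = z≤n
  tail≥ (suc i) (s≤s i<r) = prefix≥ i i<r
  prefix≥′ : ∀ i → i < suc r → suc i * t ≤ prefixSum (κ i) (toList (d₁ ⊕ d₂))
  prefix≥′ i i<r = begin
    t + i * t
      ≤⟨ +-mono-≤ (≤-trans (≤-reflexive (sym prefix≡)) (prefixSum-mono (toList d₁) (mono (z≤n {i})))) (tail≥ i i<r) ⟩
    prefixSum (κ i) (toList d₁) + prefixSum (κ i) (toList d₂)
      ≡⟨ prefixSum-⊕ (κ i) d₁ d₂ ⟨
    prefixSum (κ i) (toList (d₁ ⊕ d₂)) ∎

-- Why greedy extraction never fails: removing degree t lowers each prefix sum by at most t, which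
-- is what the lower bounds for the remaining factors allow, whichever variables were taken. The
-- narrowest factor is served first.
sumVars^-remainder : ∀ {m} k t {d e : Exponent m} → Occurs (sumVars k ^ᴾ t) d →
  ∀ j {a} → t + a ≤ prefixSum j (toList (d ⊕ e)) → a ≤ prefixSum j (toList e)
sumVars^-remainder k t {d} {e} d∈ j {a} t+a≤ = +-cancelˡ-≤ t _ _ (begin
  t + a                                             ≤⟨ t+a≤ ⟩
  prefixSum j (toList (d ⊕ e))                      ≡⟨ prefixSum-⊕ j d e ⟩
  prefixSum j (toList d) + prefixSum j (toList e)   ≤⟨ +-monoˡ-≤ _ (prefixSum-≤-sum j (toList d)) ⟩
  sum (toList d) + prefixSum j (toList e)           ≡⟨ cong (_+ prefixSum j (toList e)) (proj₂ (sumVars^-occurs⁻ k t d∈)) ⟩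
  t + prefixSum j (toList e)                        ∎)
  where open ≤-Reasoning

powerProduct-extract : ∀ {m} κ t r → Monotone κ → (e : Exponent m) →
  (∀ i → i < r → suc i * t ≤ prefixSum (κ i) (toList e)) →
  ∃[ d ] ∃[ e′ ] Occurs (powerProduct κ t r) d × e ≡ d ⊕ e′
powerProduct-extract κ t zero    mono e _ = 0ᵉ , e , here refl , sym (⊕-identityˡ e)
powerProduct-extract κ t (suc r) mono e prefix≥
  with sumVars^-extract (κ 0) t e (subst (_≤ prefixSum (κ 0) (toList e)) (+-identityʳ t) (prefix≥ 0 (s≤s z≤n)))
... | d₁ , e₁ , d₁∈ , refl
  with powerProduct-extract (κ ∘ suc) t r (mono ∘ s≤s) e₁
         (λ i i<r → sumVars^-remainder (κ 0) t d₁∈ (κ (suc i)) (prefix≥ (suc i) (s≤s i<r)))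
... | d₂ , e′ , d₂∈ , refl =
  d₁ ⊕ d₂ , e′ , occurs-*⁺ {p = sumVars (κ 0) ^ᴾ t} d₁∈ d₂∈ , sym (⊕-assoc d₁ d₂ e′)

Z-factor : ∀ {m} s t r →
  foldr _*ᴾ_ 1ᴾ (map (λ j → sumVars {m} (s * j) ^ᴾ t) (map suc (upTo r))) ≡ powerProduct (λ j → s * suc j) t r
Z-factor s t r = cong (foldr _*ᴾ_ 1ᴾ)
  (trans (cong (map _) (Listₚ.map-upTo suc r)) (Listₚ.map-applyUpTo suc _ r))

-- The vacuous case i = 0 is included so that i = n - j runs through the whole range when j runs
-- over the block counts 1, ..., n of L. The factor with exponent t - 1 involves all variables and
-- enters only through the total.
HallCondition : (n s t : ℕ) → Exponent (s * n) → Set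
HallCondition n s t e = (∀ i → i < n → i * t ≤ prefixSum (s * i) (toList e)) × sum (toList e) ≡ t * n ∸ 1

module _ (n s t : ℕ) .{{_ : NonZero n}} .{{_ : NonZero t}} where

  private
    κ : ℕ → ℕ
    κ j = s * suc j

    κ-mono : Monotone κ
    κ-mono i≤j = *-monoʳ-≤ s (s≤s i≤j)

    W : Poly (s * n)
    W = powerProduct κ t (n ∸ 1)

    V : Poly (s * n)
    V = sumVars (s * n) ^ᴾ (t ∸ 1)

    Z≡V*W : Z n s t ≡ V *ᴾ W
    Z≡V*W = cong (V *ᴾ_) (Z-factor s t (n ∸ 1))

    allOnes-V : AllOnes V
    allOnes-V = allOnes-^ (t ∸ 1) (allOnes-sumVars (s * n))

    allOnes-W : AllOnes W
    allOnes-W = allOnes-powerProduct κ t (n ∸ 1)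

    degree : t ∸ 1 + (n ∸ 1) * t ≡ t * n ∸ 1
    degree = begin
      t ∸ 1 + (n ∸ 1) * t       ≡⟨ +-∸-comm {t} ((n ∸ 1) * t) {1} (>-nonZero⁻¹ t) ⟨
      t + (n ∸ 1) * t ∸ 1       ≡⟨ cong (λ k → k * t ∸ 1) (suc-pred n) ⟩
      n * t ∸ 1                 ≡⟨ cong (_∸ 1) (*-comm n t) ⟩
      t * n ∸ 1                 ∎
      where open ≡-Reasoning

  allOnes-Z : AllOnes (Z n s t)
  allOnes-Z = subst AllOnes (sym Z≡V*W) (allOnes-* {p = V} allOnes-V allOnes-W)

  occurs⇒Hall : ∀ {e} → Occurs (Z n s t) e → HallCondition n s t e
  occurs⇒Hall {e} e∈ with occurs-*⁻ {p = V} allOnes-V allOnes-W (subst (λ p → Occurs p e) Z≡V*W e∈)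
  ... | d₁ , d₂ , d₁∈ , d₂∈ , refl with sumVars^-occurs⁻ (s * n) (t ∸ 1) d₁∈ | powerProduct-occurs⁻ κ t (n ∸ 1) κ-mono d₂∈
  ... | _ , sum≡ | prefix≥ , sum≡′ = prefix≥′ , trans (sum-⊕ d₁ d₂) (trans (cong₂ _+_ sum≡ sum≡′) degree)
    where
    open ≤-Reasoning
    prefix≥′ : ∀ i → i < n → i * t ≤ prefixSum (s * i) (toList (d₁ ⊕ d₂))
    prefix≥′ zero    _   = z≤n
    prefix≥′ (suc i) i<n = begin
      suc i * t                                                     ≤⟨ prefix≥ i (∸-monoˡ-≤ 1 i<n) ⟩
      prefixSum (κ i) (toList d₂)                                   ≤⟨ m≤n+m _ _ ⟩
      prefixSum (κ i) (toList d₁) + prefixSum (κ i) (toList d₂)     ≡⟨ prefixSum-⊕ (κ i) d₁ d₂ ⟨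
      prefixSum (κ i) (toList (d₁ ⊕ d₂))                            ∎

  private
    W-remainder : ∀ {d e} → Occurs W d → sum (toList (d ⊕ e)) ≡ t * n ∸ 1 → sum (toList e) ≡ t ∸ 1
    W-remainder {d} {e} d∈ sum≡ = +-cancelʳ-≡ ((n ∸ 1) * t) _ _ (begin
      sum (toList e) + (n ∸ 1) * t     ≡⟨ cong (sum (toList e) +_) (proj₂ (powerProduct-occurs⁻ κ t (n ∸ 1) κ-mono d∈)) ⟨
      sum (toList e) + sum (toList d)  ≡⟨ +-comm (sum (toList e)) _ ⟩
      sum (toList d) + sum (toList e)  ≡⟨ sum-⊕ d e ⟨
      sum (toList (d ⊕ e))             ≡⟨ trans sum≡ (sym degree) ⟩
      t ∸ 1 + (n ∸ 1) * t              ∎)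
      where open ≡-Reasoning

  -- The restrictive factors `W` are served first. What is left has degree t - 1 and may use every
  -- variable, so extracting `V` from it succeeds and leaves the remainder zero.
  Hall⇒occurs : ∀ {e} → HallCondition n s t e → Occurs (Z n s t) e
  Hall⇒occurs {e} (prefix≥ , sum≡)
    with powerProduct-extract κ t (n ∸ 1) κ-mono e
           (λ i i< → prefix≥ (suc i) (subst (suc i <_) (suc-pred n) (s≤s i<)))
  ... | d₂ , e₁ , d₂∈ , refl with sumVars^-extract (s * n) (t ∸ 1) e₁ (≤-reflexive (sym (trans
         (prefixSum-all (toList e₁) (≤-reflexive (Vecₚ.length-toList e₁))) (W-remainder d₂∈ sum≡))))
  ... | d₁ , e′ , d₁∈ , refl = subst₂ Occurs (sym Z≡V*W) d₁⊕d₂≡ (occurs-*⁺ {p = V} d₁∈ d₂∈)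
    where
    e′≡0 : e′ ≡ 0ᵉ
    e′≡0 = sum≡0⇒0ᵉ e′ (+-cancelˡ-≡ (t ∸ 1) _ _ (begin
      t ∸ 1 + sum (toList e′)            ≡⟨ cong (_+ sum (toList e′)) (proj₂ (sumVars^-occurs⁻ (s * n) (t ∸ 1) d₁∈)) ⟨
      sum (toList d₁) + sum (toList e′)  ≡⟨ sum-⊕ d₁ e′ ⟨
      sum (toList (d₁ ⊕ e′))             ≡⟨ W-remainder d₂∈ sum≡ ⟩
      t ∸ 1                              ≡⟨ +-identityʳ _ ⟨
      t ∸ 1 + 0                          ∎))
      where open ≡-Reasoning
    d₁⊕d₂≡ : d₁ ⊕ d₂ ≡ d₂ ⊕ (d₁ ⊕ e′)
    d₁⊕d₂≡ = trans (⊕-comm d₁ d₂) (cong (d₂ ⊕_) (sym (trans (cong (d₁ ⊕_) e′≡0) (⊕-identityʳ d₁))))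

-- From Hall's condition to membership in L

-- k ∈L t is definitionally Ballot n t (toList k).
Ballot : ℕ → ℕ → List ℕ → Set
Ballot n t xs = (∀ (j : Fin n) → prefixSum (suc (toℕ j)) xs ≤ t * suc (toℕ j) ∸ 1) × sum xs ≡ t * n ∸ 1

Ballot? : ∀ n t xs → Dec (Ballot n t xs)
Ballot? n t xs = all? (λ j → prefixSum (suc (toℕ j)) xs ≤? t * suc (toℕ j) ∸ 1) ×-dec sum xs ≟ t * n ∸ 1

-- Splits the total t n - 1 into Hall's bound for the first i blocks and the bound of L for the
-- other j + 1. Hence the two bounds are complementary.
blockLevel : ∀ t i j .{{_ : NonZero t}} → t * (i + suc j) ∸ 1 ≡ i * t + (t * suc j ∸ 1)
blockLevel t@(suc _) i j = begin
  t * (i + suc j) ∸ 1        ≡⟨ cong (_∸ 1) (*-distribˡ-+ t i (suc j)) ⟩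
  t * i + t * suc j ∸ 1      ≡⟨ +-∸-assoc (t * i) (s≤s z≤n) ⟩
  t * i + (t * suc j ∸ 1)    ≡⟨ cong (_+ (t * suc j ∸ 1)) (*-comm t i) ⟩
  i * t + (t * suc j ∸ 1)    ∎
  where open ≡-Reasoning

exchange-≤ : ∀ {a b c d} → a + b ≡ c + d → a ≤ d → c ≤ b
exchange-≤ {a} {b} {c} {d} eq a≤d = +-cancelˡ-≤ d c b (begin
  d + c  ≡⟨ trans (+-comm d c) (sym eq) ⟩
  a + b  ≤⟨ +-monoˡ-≤ b a≤d ⟩
  d + b  ∎)
  where open ≤-Reasoning

module _ (n s t : ℕ) .{{_ : NonZero t}} (e : Exponent (s * n)) where
  private
    xs = toList e
    ys = toList (reverse e)

    length-ys : length ys ≡ n * s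
    length-ys = trans (Vecₚ.length-toList (reverse e)) (*-comm s n)

    -- The first j + 1 blocks of the reversed vector and the first i blocks of `e` together use
    -- every entry once. Through `exchange-≤`, an upper bound on one part becomes a lower bound on
    -- the other.
    complement : ∀ i j → i + suc j ≡ n → sum xs ≡ t * n ∸ 1 →
      prefixSum (suc j) (blockSums s n ys) + prefixSum (s * i) xs ≡ i * t + (t * suc j ∸ 1)
    complement i j refl sum≡ = begin
      prefixSum (suc j) (blockSums s n ys) + prefixSum (s * i) xs
        ≡⟨ cong (_+ prefixSum (s * i) xs) (prefixSum-blockSums s ys (m≤n+m (suc j) i)) ⟩
      prefixSum (suc j * s) ys + prefixSum (s * i) xs
        ≡⟨ cong (λ zs → prefixSum (suc j * s) zs + prefixSum (s * i) xs) (Vecₚ.toList-reverse e) ⟩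
      prefixSum (suc j * s) (List.reverse xs) + prefixSum (s * i) xs
        ≡⟨ prefixSum-reverse {suc j * s} {s * i} xs (trans (lemma (suc j) s i) (sym (Vecₚ.length-toList e))) ⟩
      sum xs
        ≡⟨ sum≡ ⟩
      t * (i + suc j) ∸ 1
        ≡⟨ blockLevel t i j ⟩
      i * t + (t * suc j ∸ 1) ∎
      where
      open ≡-Reasoning
      lemma : ∀ k s i → k * s + s * i ≡ s * (i + k)
      lemma = solve-∀

    sum-ys : sum (blockSums s n ys) ≡ sum xs
    sum-ys = trans (sum-blockSums s n ys length-ys)
      (trans (cong sum (Vecₚ.toList-reverse e)) (sum-↭ (↭-reverse xs)))

  Hall⇒ballot : HallCondition n s t e → Ballot n t (blockSums s n ys)
  Hall⇒ballot (prefix≥ , sum≡) = below , trans sum-ys sum≡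
    where
    below : ∀ (j : Fin n) → prefixSum (suc (toℕ j)) (blockSums s n ys) ≤ t * suc (toℕ j) ∸ 1
    below j = exchange-≤ (sym (complement i (toℕ j) i+≡n sum≡)) (prefix≥ i i<n)
      where
      i = n ∸ suc (toℕ j)
      i+≡n : i + suc (toℕ j) ≡ n
      i+≡n = m∸n+n≡m (toℕ<n j)
      i<n : i < n
      i<n = ≤-trans (m<m+n i (s≤s z≤n)) (≤-reflexive i+≡n)

  ballot⇒Hall : Ballot n t (blockSums s n ys) → HallCondition n s t e
  ballot⇒Hall (below , sum≡) = prefix≥ , sum≡′
    where
    sum≡′ = trans (sym sum-ys) sum≡
    prefix≥ : ∀ i → i < n → i * t ≤ prefixSum (s * i) xs
    prefix≥ i i<n with m≤n⇒∃[o]m+o≡n i<n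
    ... | j , refl = exchange-≤ (complement i j (+-suc i j) sum≡′)
      (subst (λ k → prefixSum (suc k) (blockSums s n ys) ≤ t * suc k ∸ 1) (toℕ-fromℕ< j<n) (below (fromℕ< j<n)))
      where
      j<n : j < suc i + j
      j<n = s≤s (m≤n+m j i)

-- Counting the monomials

module _ (n s t : ℕ) .{{_ : NonZero n}} .{{_ : NonZero t}} where
  private
    Reversed : Exponent (s * n) → Set
    Reversed e = Ballot n t (blockSums s n (toList (reverse e)))

    Reversed? : ∀ e → Dec (Reversed e)
    Reversed? e = Ballot? n t (blockSums s n (toList (reverse e)))

  coeff≢0⇒ballot : ∀ {e} → coeff (Z n s t) e ≢ 0ℤ → Ballot n t (blockSums s n (toList (reverse e)))
  coeff≢0⇒ballot {e} ≢0 = Hall⇒ballot n s t e (occurs⇒Hall n s t (coeff≢0⇒occurs (allOnes-Z n s t) ≢0))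

  ballot⇒coeff≢0 : ∀ {e} → Ballot n t (blockSums s n (toList (reverse e))) → coeff (Z n s t) e ≢ 0ℤ
  ballot⇒coeff≢0 {e} ballot = occurs⇒coeff≢0 (allOnes-Z n s t) (Hall⇒occurs n s t (ballot⇒Hall n s t e ballot))

  N-∑ : N (Z n s t) ≡ ∑ (box (s * n) (t * n)) (λ e → indicator (Reversed? e))
  N-∑ = trans
    (unique-length
      (Uniqueₚ.filter⁺ nonzero? (deduplicate-! _≟ᵉ_ exponents))
      (Uniqueₚ.filter⁺ Reversed? (box-! (s * n) (t * n)))
      (mk⇔ to from))
    (length-filter-∑ Reversed? (box (s * n) (t * n)))
    where
    exponents = map proj₂ (Z n s t)
    nonzero? = λ e → ¬? (coeff (Z n s t) e ℤₚ.≟ 0ℤ)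
    to : ∀ {e} → e ∈ filter nonzero? (deduplicate _≟ᵉ_ exponents) → e ∈ filter Reversed? (box (s * n) (t * n))
    to {e} e∈ = ∈-filter⁺ Reversed? (∈-box e sum<) ballot
      where
      ballot : Reversed e
      ballot = coeff≢0⇒ballot (proj₂ (∈-filter⁻ nonzero? {xs = deduplicate _≟ᵉ_ exponents} e∈))
      sum< : sum (toList e) < t * n
      sum< = subst (_< t * n) (sym (proj₂ (ballot⇒Hall n s t e ballot))) (∸1< (t * n) {{m*n≢0 t n}})
    from : ∀ {e} → e ∈ filter Reversed? (box (s * n) (t * n)) → e ∈ filter nonzero? (deduplicate _≟ᵉ_ exponents)
    from {e} e∈ = ∈-filter⁺ nonzero?
      (∈-deduplicate⁺ _≟ᵉ_ (∈-map⁺ proj₂ (coeff≢0⇒occurs (allOnes-Z n s t) coeff≢0))) coeff≢0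
      where
      coeff≢0 : coeff (Z n s t) e ≢ 0ℤ
      coeff≢0 = ballot⇒coeff≢0 (proj₂ (∈-filter⁻ Reversed? {xs = box (s * n) (t * n)} e∈))

  N≡sumOverL : N (Z n s t) ≡ sumOverL n s t
  N≡sumOverL = begin
    N (Z n s t)
      ≡⟨ N-∑ ⟩
    ∑ (box (s * n) b) (F ∘ blockSums s n ∘ toList ∘ reverse)
      ≡⟨ ∑-box-reverse (s * n) b (F ∘ blockSums s n ∘ toList) ⟩
    ∑ (box (s * n) b) (F ∘ blockSums s n ∘ toList)
      -- The summand factors through lists, so commuting s and n changes only the dimension of the
      -- box.
      ≡⟨ cong (λ m → ∑ (box m b) (F ∘ blockSums s n ∘ toList)) (*-comm s n) ⟩
    ∑ (box (n * s) b) (F ∘ blockSums s n ∘ toList)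
      ≡⟨ ∑-box-blockSums s n b F F≡0 ⟩
    ∑ (box n b) (λ k → weight s (toList k) * F (toList k))
      ≡⟨ sumOverL-weight n s t ⟨
    sumOverL n s t ∎
    where
    open ≡-Reasoning
    b = t * n
    F : List ℕ → ℕ
    F xs = indicator (Ballot? n t xs)
    F≡0 : ∀ xs → b ≤ sum xs → F xs ≡ 0
    F≡0 xs b≤ = indicator-no (Ballot? n t xs) λ (_ , sum≡) →
      <⇒≱ (∸1< b {{m*n≢0 t n}}) (subst (b ≤_) sum≡ b≤)

  n*sumOverL-C : .{{_ : NonZero s}} → n * sumOverL n s t ≡ ((s + t) * n ∸ 2) C (t * n ∸ 1)
  n*sumOverL-C = begin
    n * sumOverL n s t
      ≡⟨ n*sumOverL n s t ⟩
    multichoose (n * s) (t * n ∸ 1)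
      ≡⟨ multichoose-C (n * s) (t * n ∸ 1) ⟩
    (t * n ∸ 1 + n * s ∸ 1) C (t * n ∸ 1)
      ≡⟨ cong (_C (t * n ∸ 1)) upper ⟩
    ((s + t) * n ∸ 2) C (t * n ∸ 1) ∎
    where
    open ≡-Reasoning
    upper : t * n ∸ 1 + n * s ∸ 1 ≡ (s + t) * n ∸ 2
    upper = begin
      t * n ∸ 1 + n * s ∸ 1     ≡⟨ cong (_∸ 1) (+-∸-comm (n * s) (>-nonZero⁻¹ (t * n) {{m*n≢0 t n}})) ⟨
      t * n + n * s ∸ 1 ∸ 1     ≡⟨ ∸-+-assoc (t * n + n * s) 1 1 ⟩
      t * n + n * s ∸ 2         ≡⟨ cong (_∸ 2) (lemma t n s) ⟩
      (s + t) * n ∸ 2           ∎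
      where
      lemma : ∀ t n s → t * n + n * s ≡ (s + t) * n
      lemma = solve-∀

-- In unnormalised fractions the claim is a cross multiplication; passing through them avoids
-- reduction to lowest terms.
divide : ∀ n {a c} .{{_ : NonZero n}} → n * a ≡ c →
  ℤ.+ a ℚ./ 1 ≡ (ℤ.+ 1 ℚ./ n) ℚ.* (ℤ.+ c ℚ./ 1)
divide n@(suc n-1) {a} {c} na≡c = ℚₚ.toℚᵘ-injective (begin
  toℚᵘ (fromℚᵘ a′)                         ≈⟨ ℚₚ.toℚᵘ-fromℚᵘ a′ ⟩
  a′                                       ≈⟨ *≡* cross ⟩
  1/n ℚᵘ.* c′                              ≈⟨ ℚᵘₚ.*-cong (ℚₚ.toℚᵘ-fromℚᵘ 1/n) (ℚₚ.toℚᵘ-fromℚᵘ c′) ⟨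
  toℚᵘ (fromℚᵘ 1/n) ℚᵘ.* toℚᵘ (fromℚᵘ c′)  ≈⟨ ℚₚ.toℚᵘ-homo-* (fromℚᵘ 1/n) (fromℚᵘ c′) ⟨
  toℚᵘ (fromℚᵘ 1/n ℚ.* fromℚᵘ c′)          ∎)
  where
  open ℚᵘₚ.≃-Reasoning
  a′ = mkℚᵘ (ℤ.+ a) 0
  c′ = mkℚᵘ (ℤ.+ c) 0
  1/n = mkℚᵘ (ℤ.+ 1) n-1
  cross : ℤ.+ a ℤ.* ℤ.+ (n * 1) ≡ (ℤ.+ 1 ℤ.* ℤ.+ c) ℤ.* ℤ.+ 1
  cross = trans (sym (ℤₚ.pos-* a (n * 1))) (trans (cong ℤ.+_
    (trans (cong (a *_) (*-identityʳ n)) (trans (*-comm a n) na≡c)))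
    (sym (trans (ℤₚ.*-identityʳ _) (ℤₚ.*-identityˡ _))))

-- Lattice paths

-- Split off so that `encodeTail (y ∷ v)` is definitionally `R ∷ encode (y ∷ v)`.
encodeTail : ∀ {m} → Vec ℕ m → Path
encodeTail []      = []
encodeTail (x ∷ v) = R ∷ replicate x U ++ encodeTail v

-- Entry i is the number of up steps on the vertical line with abscissa i; m right steps separate m
-- + 1 such lines.
encode : ∀ {m} → Vec ℕ (suc m) → Path
encode (x ∷ v) = replicate x U ++ encodeTail v

raise : ∀ {m} → Vec ℕ (suc m) → Vec ℕ (suc m)
raise (x ∷ v) = suc x ∷ v

-- Only meaningful on paths with m right steps.
decode : ∀ m → Path → Vec ℕ (suc m)
decode m       []      = 0ᵉ
decode m       (U ∷ w) = raise (decode m w)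
decode zero    (R ∷ w) = 0ᵉ
decode (suc m) (R ∷ w) = 0 ∷ decode m w

decode-encode : ∀ {m} (v : Vec ℕ (suc m)) → decode m (encode v) ≡ v
decode-encode (suc x ∷ v)    = cong raise (decode-encode (x ∷ v))
decode-encode (zero ∷ [])    = refl
decode-encode (zero ∷ y ∷ v) = cong (0 ∷_) (decode-encode (y ∷ v))

encode-raise : ∀ {m} (v : Vec ℕ (suc m)) → encode (raise v) ≡ U ∷ encode v
encode-raise (x ∷ v) = refl

encode-0∷ : ∀ {m} (v : Vec ℕ (suc m)) → encode (0 ∷ v) ≡ R ∷ encode v
encode-0∷ (x ∷ v) = refl

countR : Path → ℕ
countR []      = 0
countR (U ∷ w) = countR w
countR (R ∷ w) = suc (countR w)

encode-decode : ∀ {m} w → countR w ≡ m → encode (decode m w) ≡ w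
encode-decode {zero}  []      _  = refl
encode-decode {m}     (U ∷ w) eq = trans (encode-raise (decode m w)) (cong (U ∷_) (encode-decode w eq))
encode-decode {suc m} (R ∷ w) eq = trans (encode-0∷ (decode m w)) (cong (R ∷_) (encode-decode w (suc-injective eq)))

abscissa-foldl : ∀ a b w → proj₁ (foldl move (a , b) w) ≡ countR w + a
abscissa-foldl a b []      = refl
abscissa-foldl a b (U ∷ w) = abscissa-foldl a (suc b) w
abscissa-foldl a b (R ∷ w) = trans (abscissa-foldl (suc a) b w) (+-suc (countR w) a)

foldl-U : ∀ k a b → foldl move (a , b) (replicate k U) ≡ (a , k + b)
foldl-U zero    a b = refl
foldl-U (suc k) a b = trans (foldl-U k a (suc b)) (cong (a ,_) (+-suc k b))

foldl-R : ∀ k a b → foldl move (a , b) (replicate k R) ≡ (k + a , b)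
foldl-R zero    a b = refl
foldl-R (suc k) a b = trans (foldl-R k (suc a) b) (cong (_, b) (+-suc k a))

foldl-encode : ∀ {m} a b (v : Vec ℕ (suc m)) → foldl move (a , b) (encode v) ≡ (m + a , sum (toList v) + b)
foldl-encode a b (x ∷ []) = trans (cong (foldl move (a , b)) (Listₚ.++-identityʳ (replicate x U)))
  (trans (foldl-U x a b) (cong (λ k → a , k + b) (sym (+-identityʳ x))))
foldl-encode {suc m} a b (x ∷ y ∷ v) = begin
  foldl move (a , b) (replicate x U ++ R ∷ encode (y ∷ v))
    ≡⟨ Listₚ.foldl-++ move (a , b) (replicate x U) _ ⟩
  foldl move (foldl move (a , b) (replicate x U)) (R ∷ encode (y ∷ v))
    ≡⟨ cong (λ p → foldl move p (R ∷ encode (y ∷ v))) (foldl-U x a b) ⟩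
  foldl move (suc a , x + b) (encode (y ∷ v))
    ≡⟨ foldl-encode (suc a) (x + b) (y ∷ v) ⟩
  m + suc a , sum (y ∷ toList v) + (x + b)
    ≡⟨ cong₂ _,_ (+-suc m a) (x∙yz≈yx∙z (sum (y ∷ toList v)) x b) ⟩
  suc m + a , sum (x ∷ y ∷ toList v) + b ∎
  where
  open ≡-Reasoning

endpoint-encode : ∀ {m} (v : Vec ℕ (suc m)) → endpoint (encode v) ≡ (m , sum (toList v))
endpoint-encode {m} v = trans (foldl-encode 0 0 v) (cong₂ _,_ (+-identityʳ m) (+-identityʳ _))

start-∈ : ∀ p w → p ∈ pointsFrom p w
start-∈ p []      = here refl
start-∈ p (_ ∷ _) = here refl

pointsFrom-++⁺ˡ : ∀ {p q} u v → q ∈ pointsFrom p u → q ∈ pointsFrom p (u ++ v)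
pointsFrom-++⁺ˡ []      v (here refl) = start-∈ _ v
pointsFrom-++⁺ˡ (_ ∷ u) v (here refl) = here refl
pointsFrom-++⁺ˡ (_ ∷ u) v (there q∈)  = there (pointsFrom-++⁺ˡ u v q∈)

pointsFrom-++⁺ʳ : ∀ {p q} u v → q ∈ pointsFrom (foldl move p u) v → q ∈ pointsFrom p (u ++ v)
pointsFrom-++⁺ʳ []      v q∈ = q∈
pointsFrom-++⁺ʳ (_ ∷ u) v q∈ = there (pointsFrom-++⁺ʳ u v q∈)

pointsFrom-++⁻ : ∀ {p q} u v → q ∈ pointsFrom p (u ++ v) → q ∈ pointsFrom p u ⊎ q ∈ pointsFrom (foldl move p u) v
pointsFrom-++⁻ []      v q∈          = inj₂ q∈
pointsFrom-++⁻ (_ ∷ u) v (here refl) = inj₁ (here refl)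
pointsFrom-++⁻ (_ ∷ u) v (there q∈)  with pointsFrom-++⁻ u v q∈
... | inj₁ q∈u = inj₁ (there q∈u)
... | inj₂ q∈v = inj₂ q∈v

pointsFrom-U⁻ : ∀ k {a b a′ b′} → (a′ , b′) ∈ pointsFrom (a , b) (replicate k U) → a′ ≡ a × b′ ≤ k + b
pointsFrom-U⁻ zero    (here refl) = refl , ≤-refl
pointsFrom-U⁻ (suc k) (here refl) = refl , m≤n+m _ (suc k)
pointsFrom-U⁻ (suc k) {b = b} (there q∈) with pointsFrom-U⁻ k q∈
... | a≡ , b≤ = a≡ , ≤-trans b≤ (≤-reflexive (+-suc k b))

pointsFrom-R⁻ : ∀ k {a b a′ b′} → (a′ , b′) ∈ pointsFrom (a , b) (replicate k R) → b′ ≡ b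
pointsFrom-R⁻ zero    (here refl) = refl
pointsFrom-R⁻ (suc k) (here refl) = refl
pointsFrom-R⁻ (suc k) (there q∈)  = pointsFrom-R⁻ k q∈

pointsFrom-R⁺ : ∀ k {r} a b → r ≤ k → (r + a , b) ∈ pointsFrom (a , b) (replicate k R)
pointsFrom-R⁺ k       a b z≤n               = start-∈ (a , b) (replicate k R)
pointsFrom-R⁺ (suc k) {suc r} a b (s≤s r≤k) =
  there (subst (λ a′ → (a′ , b) ∈ pointsFrom (suc a , b) (replicate k R)) (+-suc r a) (pointsFrom-R⁺ k (suc a) b r≤k))

abscissa-≤ : ∀ {a b a′ b′} w → (a′ , b′) ∈ pointsFrom (a , b) w → a ≤ a′
abscissa-≤ []      (here refl) = ≤-refl
abscissa-≤ (_ ∷ w) (here refl) = ≤-refl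
abscissa-≤ (U ∷ w) (there q∈)  = abscissa-≤ w q∈
abscissa-≤ (R ∷ w) (there q∈)  = ≤-trans (n≤1+n _) (abscissa-≤ w q∈)

encode-points⁻ : ∀ {m} a b (v : Vec ℕ (suc m)) {a′ b′} → (a′ , b′) ∈ pointsFrom (a , b) (encode v) →
  ∃[ i ] i ≤ m × a′ ≡ i + a × b′ ≤ prefixSum (suc i) (toList v) + b
encode-points⁻ a b (x ∷ v) q∈ with pointsFrom-++⁻ (replicate x U) (encodeTail v) q∈
encode-points⁻ a b (x ∷ v) q∈ | inj₁ q∈U with pointsFrom-U⁻ x q∈U
... | a≡ , b≤ = 0 , z≤n , a≡ , subst (λ k → _ ≤ k + b) (sym (+-identityʳ x)) b≤
encode-points⁻ a b (x ∷ v) q∈ | inj₂ q∈R rewrite foldl-U x a b with v | q∈R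
... | []    | here refl = 0 , z≤n , refl , ≤-reflexive (cong (_+ b) (sym (+-identityʳ x)))
... | y ∷ v | here refl = 0 , z≤n , refl , ≤-reflexive (cong (_+ b) (sym (+-identityʳ x)))
... | y ∷ v | there q∈′ with encode-points⁻ (suc a) (x + b) (y ∷ v) q∈′
...   | i , i≤m , a≡ , b≤ = suc i , s≤s i≤m , trans a≡ (+-suc i a) ,
  ≤-trans b≤ (≤-reflexive (x∙yz≈yx∙z (prefixSum (suc i) (y ∷ toList v)) x b))

-- The top of each column lies on the path and, by `encode-points⁻`, is the highest point there, so
-- column tops decide whether the path stays beneath another.
encode-points⁺ : ∀ {m} a b (v : Vec ℕ (suc m)) {i} → i ≤ m →
  (i + a , prefixSum (suc i) (toList v) + b) ∈ pointsFrom (a , b) (encode v)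
encode-points⁺ a b (x ∷ v) {zero} _ = pointsFrom-++⁺ʳ (replicate x U) (encodeTail v)
  (subst (λ p → (a , x + 0 + b) ∈ pointsFrom p (encodeTail v)) (sym (foldl-U x a b))
    (subst (λ k → (a , k + b) ∈ pointsFrom (a , x + b) (encodeTail v)) (sym (+-identityʳ x)) (start-∈ _ (encodeTail v))))
encode-points⁺ a b (x ∷ y ∷ v) {suc i} (s≤s i≤m) = pointsFrom-++⁺ʳ (replicate x U) (encodeTail (y ∷ v))
  (subst₂ (λ q p → q ∈ pointsFrom p (encodeTail (y ∷ v)))
    (cong₂ _,_ (+-suc i a) (x∙yz≈yx∙z (prefixSum (suc i) (y ∷ toList v)) x b)) (sym (foldl-U x a b))
    (there (encode-points⁺ (suc a) (x + b) (y ∷ v) i≤m)))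

-- The boundary path and its heights

staircase : (k s t : ℕ) → Path
staircase k s t = concat (replicate k (replicate s R ++ replicate t U)) ++ replicate (s ∸ 1) R

staircase-suc : ∀ k s t → staircase (suc k) s t ≡ replicate s R ++ replicate t U ++ staircase k s t
staircase-suc k s t = trans (Listₚ.++-assoc (replicate s R ++ replicate t U) _ _)
  (Listₚ.++-assoc (replicate s R) (replicate t U) _)

-- For r < s these are the points of the horizontal run at relative height i t, without the right
-- end from which the next U^t rises. The last run has only s - 1 steps and so provides exactly
-- these r.
staircase-corner : ∀ k s t {a b i r} → i ≤ k → r < s →
  (r + i * s + a , i * t + b) ∈ pointsFrom (a , b) (staircase k s t)
staircase-corner zero (suc s) t {a} {b} {r = r} z≤n (s≤s r≤s) =
  subst (λ k → (k + a , b) ∈ pointsFrom (a , b) (replicate s R)) (sym (+-identityʳ r)) (pointsFrom-R⁺ s a b r≤s)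
staircase-corner (suc k) s t {a} {b} {r = r} z≤n r<s =
  subst₂ (λ j w → (j + a , b) ∈ pointsFrom (a , b) w) (sym (+-identityʳ r)) (sym (staircase-suc k s t))
    (pointsFrom-++⁺ˡ (replicate s R) _ (pointsFrom-R⁺ s a b (<⇒≤ r<s)))
staircase-corner (suc k) s t {a} {b} {suc i} {r} (s≤s i≤k) r<s =
  subst₂ (λ q w → q ∈ pointsFrom (a , b) w) (cong₂ _,_ (lemma r (i * s) s a) (x∙yz≈yx∙z (i * t) t b)) (sym (staircase-suc k s t))
    (pointsFrom-++⁺ʳ (replicate s R) _ (subst (λ p → q ∈ pointsFrom p (replicate t U ++ staircase k s t)) (sym (foldl-R s a b))
      (pointsFrom-++⁺ʳ (replicate t U) _ (subst (λ p → q ∈ pointsFrom p (staircase k s t)) (sym (foldl-U t (s + a) b))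
        (staircase-corner k s t i≤k r<s)))))
  where
  q = (r + i * s + (s + a) , i * t + (t + b))
  lemma : ∀ r p s a → r + p + (s + a) ≡ r + (s + p) + a
  lemma = solve-∀

-- The height cannot exceed i t before the (i+1)-st vertical run, whose relative abscissa is (i + 1)
-- s.
staircase-below : ∀ k s t {a b a′ b′} i → (a′ , b′) ∈ pointsFrom (a , b) (staircase k s t) →
  a′ < suc i * s + a → b′ ≤ i * t + b
staircase-below zero s t {b = b} i q∈ _ = ≤-trans (≤-reflexive (pointsFrom-R⁻ (s ∸ 1) q∈)) (m≤n+m b (i * t))
staircase-below (suc k) s t {a} {b} {a′} i q∈ a′<
  with pointsFrom-++⁻ (replicate s R) _ (subst (λ w → _ ∈ pointsFrom (a , b) w) (staircase-suc k s t) q∈)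
... | inj₁ q∈R = ≤-trans (≤-reflexive (pointsFrom-R⁻ s q∈R)) (m≤n+m b (i * t))
... | inj₂ q∈′ rewrite foldl-R s a b with i | pointsFrom-++⁻ (replicate t U) (staircase k s t) q∈′
-- After the first s right steps the relative abscissa is at least s, contrary to the bound for i =
-- 0.
...   | zero | _ = contradiction (abscissa-≤ (replicate t U ++ staircase k s t) q∈′)
        (<⇒≱ (subst (λ j → _ < j + a) (+-identityʳ s) a′<))
...   | suc i | inj₁ q∈U = ≤-trans (proj₂ (pointsFrom-U⁻ t q∈U)) (+-monoˡ-≤ b (m≤m+n t (i * t)))
...   | suc i | inj₂ q∈S rewrite foldl-U t (s + a) b = ≤-trans
        (staircase-below k s t i q∈S (subst (a′ <_) (sym (x∙yz≈yx∙z (suc i * s) s a)) a′<))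
        (≤-reflexive (x∙yz≈yx∙z (i * t) t b))

module _ (n s t : ℕ) .{{_ : NonZero n}} .{{_ : NonZero s}} .{{_ : NonZero t}} where
  private
    -- Here the boundary meets L: the initial U^{t-1} followed by j runs U^t reaches the bound that
    -- L puts on the first j + 1 sums.
    blockTop : ∀ j → j * t + (t ∸ 1) ≡ t * suc j ∸ 1
    blockTop j = sym (trans (cong (λ k → t * k ∸ 1) (+-comm 1 j))
      (trans (blockLevel t j 0) (cong (λ k → j * t + (k ∸ 1)) (*-identityʳ t))))

  boundary-corner : ∀ {j r} → j < n → r < s → (r + j * s , t * suc j ∸ 1) ∈ points (boundary n s t)
  boundary-corner {j} {r} j<n r<s = pointsFrom-++⁺ʳ (replicate (t ∸ 1) U) (staircase (n ∸ 1) s t)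
    (subst₂ (λ q p → q ∈ pointsFrom p (staircase (n ∸ 1) s t))
      (cong₂ _,_ (+-identityʳ _) (blockTop j))
      (sym (trans (foldl-U (t ∸ 1) 0 0) (cong (0 ,_) (+-identityʳ (t ∸ 1)))))
      (staircase-corner (n ∸ 1) s t (∸-monoˡ-≤ 1 j<n) r<s))

  boundary-below : ∀ {a b} j → (a , b) ∈ points (boundary n s t) → a < suc j * s → b ≤ t * suc j ∸ 1
  boundary-below {a} {b} j q∈ a< = subst (b ≤_) (blockTop j) (level (pointsFrom-++⁻ (replicate (t ∸ 1) U) _ q∈))
    where
    level : (a , b) ∈ pointsFrom (0 , 0) (replicate (t ∸ 1) U) ⊎
            (a , b) ∈ pointsFrom (foldl move (0 , 0) (replicate (t ∸ 1) U)) (staircase (n ∸ 1) s t) →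
            b ≤ j * t + (t ∸ 1)
    level (inj₁ q∈U) = ≤-trans (proj₂ (pointsFrom-U⁻ (t ∸ 1) q∈U))
      (≤-trans (≤-reflexive (+-identityʳ (t ∸ 1))) (m≤n+m _ (j * t)))
    level (inj₂ q∈S) = staircase-below (n ∸ 1) s t j
      (subst (λ p → (a , b) ∈ pointsFrom p (staircase (n ∸ 1) s t))
        (trans (foldl-U (t ∸ 1) 0 0) (cong (0 ,_) (+-identityʳ (t ∸ 1)))) q∈S)
      (subst (a <_) (sym (+-identityʳ _)) a<)

  module _ {m} (length≡ : suc m ≡ s * n) (v : Vec ℕ (suc m)) where
    private
      xs = toList v

      length-xs : length xs ≡ n * s
      length-xs = trans (Vecₚ.length-toList v) (trans length≡ (*-comm s n))

      prefixSum-block : ∀ {j} → j < n → prefixSum (suc j) (blockSums s n xs) ≡ prefixSum (suc j * s) xs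
      prefixSum-block = prefixSum-blockSums s xs

    ballot⇒sum : Ballot n t (blockSums s n xs) → sum xs ≡ t * n ∸ 1
    ballot⇒sum (_ , sum≡) = trans (sym (sum-blockSums s n xs length-xs)) sum≡

    -- The boundary's top height is constant on a block of s columns. A point in column i belongs to
    -- block i / s, and its height is at most the sum up to the end of that block.
    ballot⇒beneath : Ballot n t (blockSums s n xs) → WeaklyBeneath (encode v) (boundary n s t)
    ballot⇒beneath (below , _) {a , b} q∈ above with encode-points⁻ 0 0 v q∈
    ... | i , i≤m , a≡ , b≤ = <⇒≱ (above (subst (λ k → (k , t * suc j ∸ 1) ∈ points (boundary n s t)) r+js≡a
            (boundary-corner j<n (m%n<n i s)))) (begin
      b                                         ≤⟨ b≤ ⟩
      prefixSum (suc i) xs + 0                  ≡⟨ +-identityʳ _ ⟩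
      prefixSum (suc i) xs                      ≤⟨ prefixSum-mono xs i<[1+j]s ⟩
      prefixSum (suc j * s) xs                  ≡⟨ prefixSum-block j<n ⟨
      prefixSum (suc j) (blockSums s n xs)      ≤⟨ subst (λ k → prefixSum (suc k) (blockSums s n xs) ≤ t * suc k ∸ 1)
                                                     (toℕ-fromℕ< j<n) (below (fromℕ< j<n)) ⟩
      t * suc j ∸ 1                             ∎)
      where
      open ≤-Reasoning
      j = i ℕ./ s
      j<n : j < n
      j<n = m<n*o⇒m/o<n (≤-trans (s≤s i≤m) (≤-reflexive (trans length≡ (*-comm s n))))
      i<[1+j]s : i < suc j * s
      i<[1+j]s = subst (_< suc j * s) (sym (m≡m%n+[m/n]*n i s)) (+-monoˡ-< (j * s) (m%n<n i s))
      r+js≡a : i % s + j * s ≡ a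
      r+js≡a = trans (sym (m≡m%n+[m/n]*n i s)) (trans (sym (+-identityʳ i)) (sym a≡))

    beneath⇒ballot : WeaklyBeneath (encode v) (boundary n s t) → sum xs ≡ t * n ∸ 1 → Ballot n t (blockSums s n xs)
    beneath⇒ballot beneath sum≡ = below , trans (sum-blockSums s n xs length-xs) sum≡
      where
      below : ∀ (j : Fin n) → prefixSum (suc (toℕ j)) (blockSums s n xs) ≤ t * suc (toℕ j) ∸ 1
      -- Being weakly beneath is a negative statement, so the bound is obtained by contradiction,
      -- using that the order on ℕ is decidable.
      below j = decidable-stable (_ ≤? _) λ ¬below →
        beneath (encode-points⁺ 0 0 v (s≤s⁻¹ column≤)) λ q∈ →
          ≤-<-trans (boundary-below (toℕ j) q∈ (≤-reflexive column)) (<-≤-trans (≰⇒> ¬below) height)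
        where
        open ≤-Reasoning
        -- The last column of block j, where the path has climbed the whole block while the boundary
        -- is still at its old height.
        k = pred (suc (toℕ j) * s)
        column : suc (k + 0) ≡ suc (toℕ j) * s
        column = trans (cong suc (+-identityʳ k)) (suc-pred (suc (toℕ j) * s) {{m*n≢0 (suc (toℕ j)) s}})
        column′ : suc k ≡ suc (toℕ j) * s
        column′ = suc-pred (suc (toℕ j) * s) {{m*n≢0 (suc (toℕ j)) s}}
        column≤ : suc k ≤ suc m
        column≤ = begin
          suc k              ≡⟨ column′ ⟩
          suc (toℕ j) * s    ≤⟨ *-monoˡ-≤ s (toℕ<n j) ⟩
          n * s              ≡⟨ trans (*-comm n s) (sym length≡) ⟩
          suc m              ∎
        height : prefixSum (suc (toℕ j)) (blockSums s n xs) ≤ prefixSum (suc k) xs + 0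
        height = begin
          prefixSum (suc (toℕ j)) (blockSums s n xs)   ≡⟨ prefixSum-block (toℕ<n j) ⟩
          prefixSum (suc (toℕ j) * s) xs               ≡⟨ cong (λ i → prefixSum i xs) column′ ⟨
          prefixSum (suc k) xs                         ≡⟨ +-identityʳ _ ⟨
          prefixSum (suc k) xs + 0                     ∎

-- The bijection and the theorem

Monomial-≡ : ∀ {m} {p : Poly m} {μ ν : Monomial p} → proj₁ μ ≡ proj₁ ν → μ ≡ ν
Monomial-≡ refl = refl

-- The beneath-components take values in the empty type and agree definitionally; the endpoint
-- equations agree by uniqueness of identity proofs.
PathsBeneath-≡ : ∀ {p Q} {P P′ : PathsBeneath p Q} → proj₁ P ≡ proj₁ P′ → P ≡ P′
PathsBeneath-≡ {P = w , e , b} {_ , e′ , _} refl = cong (λ e → w , e , λ {p} → b {p}) (≡-irrelevant e e′)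

monomials↔paths : ∀ n s t .{{_ : NonZero n}} .{{_ : NonZero s}} .{{_ : NonZero t}} →
  Monomial (Z n s t) ↔ PathsBeneath (s * n ∸ 1 , t * n ∸ 1) (boundary n s t)
monomials↔paths n@(suc _) s@(suc _) t = mk↔ₛ′ to from
  (λ where P@(w , _) → PathsBeneath-≡ {P = to (from P)} (trans
             (cong encode (Vecₚ.reverse-involutive (decode m w))) (encode-decode w (countR≡ P))))
  (λ where (e , _) → Monomial-≡ {p = Z n s t} (trans
             (cong reverse (decode-encode (reverse e))) (Vecₚ.reverse-involutive e)))
  where
  -- As n and s are matched as successors, `suc m` is definitionally `s * n`; this is why `refl`
  -- serves as the length equation below.
  m = s * n ∸ 1

  Paths = PathsBeneath (s * n ∸ 1 , t * n ∸ 1) (boundary n s t)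

  to : Monomial (Z n s t) → Paths
  to (e , ≢0) = encode (reverse e) ,
    trans (endpoint-encode (reverse e)) (cong (m ,_) (ballot⇒sum n s t refl (reverse e) ballot)) ,
    λ {p} → ballot⇒beneath n s t refl (reverse e) ballot {p}
    where ballot = coeff≢0⇒ballot n s t ≢0

  countR≡ : ((w , _) : Paths) → countR w ≡ m
  countR≡ (w , end , _) = trans (sym (+-identityʳ _)) (trans (sym (abscissa-foldl 0 0 w)) (cong proj₁ end))

  from : Paths → Monomial (Z n s t)
  from P@(w , end , beneath) = reverse v , ballot⇒coeff≢0 n s t
    (subst (λ u → Ballot n t (blockSums s n (toList u))) (sym (Vecₚ.reverse-involutive v))
      (beneath⇒ballot n s t refl v
        (subst (λ w → WeaklyBeneath w (boundary n s t)) (sym encode-v≡w) beneath)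
        (cong proj₂ (trans (sym (endpoint-encode v)) (trans (cong endpoint encode-v≡w) end)))))
    where
    v = decode m w
    encode-v≡w : encode v ≡ w
    encode-v≡w = encode-decode w (countR≡ P)

open import Data.Integer.Base using (+_)
open import Data.Rational.Base using (_/_)

-- The lower index of the binomial coefficient is t n - 1, not the n - 1 of the English statement.
-- With n - 1 the formula fails: for n = 1 and s = t = 2, Z = x₁ + x₂ has two monomials, while C(2,
-- 0) = 1.
corollary4p5 : (n s t : ℕ) .{{_ : NonZero n}} .{{_ : NonZero s}} .{{_ : NonZero t}} →
    (Monomial (Z n s t) ↔ PathsBeneath (s * n ∸ 1 , t * n ∸ 1) (boundary n s t))
    × (N (Z n s t) ≡ sumOverL n s t)
    × (+ sumOverL n s t / 1 ≡ (+ 1 / n) ℚ.* (+ (((s + t) * n ∸ 2) C (t * n ∸ 1)) / 1))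
corollary4p5 n s t = monomials↔paths n s t , N≡sumOverL n s t , divide n (n*sumOverL-C n s t)
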